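{- Let $p$ be a prime, $m$ a positive integer, and $n$ an even positive integer divisible by $p^m$. If $k$ is an integer divisible by $p$, then $S_{n-1,k-1}$, $P_{n-1,k-1}$, $Q_{n-1,k-1}$, $R_{n-1,k-1}$ and $D_{n-1,k-1}$ are all divisible by $p^m$.
   Context: For a permutation $A = a_1\cdots a_N$ of $[N]=\{1,\dots,N\}$, an ascent is an index $i$ ($1\le i\le N-1$) with $a_i<a_{i+1}$; $A$ is even/odd according to the parity of its number of inversions (pairs $i<j$ with $a_i>a_j$). For an integer $j$, let $B_{N,j}$, $C_{N,j}$ be the numbers of even, resp. odd, permutations of $[N]$ with exactly $j$ ascents (these are $0$ if $j<0$ or $j>N-1$), and $D_{N,j}=B_{N,j}-C_{N,j}$. A permutation is parity-alternate (a PAP) if its consecutive entries alternate between even and odd integers. Let $S_{N,j}$ be the number of PAPs of $[N]$ with exactly $j$ ascents, $P_{N,j}$ the number of even ones among them, $Q_{N,j}$ the number of odd ones, and $R_{N,j}=P_{N,j}-Q_{N,j}$. -}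

module Defs where

open import Data.Nat using (ℕ; zero; suc; _<ᵇ_; _%_; _≡ᵇ_)
open import Data.Bool using (Bool; true; false; not; _∧_; if_then_else_)
open import Data.List using (List; []; _∷_; [_]; map; concatMap; upTo; length)
open import Relation.Nullary.Decidable using (⌊_⌋)
open import Data.Integer using (ℤ; +_; _-_)
import Data.Integer as ℤ

filterᵇ : {A : Set} → (A → Bool) → List A → List A
filterᵇ f [] = []
filterᵇ f (x ∷ xs) = if f x then x ∷ filterᵇ f xs else filterᵇ f xs

countᵇ : {A : Set} → (A → Bool) → List A → ℕ
countᵇ f xs = length (filterᵇ f xs)

words : ℕ → ℕ → List (List ℕ)
words N zero = [ [] ]
words N (suc L) = concatMap (λ w → map (λ a → a ∷ w) (map suc (upTo N))) (words N L)

notIn : ℕ → List ℕ → Bool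
notIn a [] = true
notIn a (b ∷ bs) = not (a ≡ᵇ b) ∧ notIn a bs

distinct : List ℕ → Bool
distinct [] = true
distinct (a ∷ as) = notIn a as ∧ distinct as

perms : ℕ → List (List ℕ)
perms N = filterᵇ distinct (words N N)

ascents : List ℕ → ℕ
ascents [] = zero
ascents (a ∷ []) = zero
ascents (a ∷ b ∷ rest) = (if a <ᵇ b then 1 else 0) Data.Nat.+ ascents (b ∷ rest)

inversions : List ℕ → ℕ
inversions [] = zero
inversions (a ∷ rest) = countᵇ (λ b → b <ᵇ a) rest Data.Nat.+ inversions rest

isEvenPerm : List ℕ → Bool
isEvenPerm w = (inversions w % 2) ≡ᵇ 0

isPAP : List ℕ → Bool
isPAP [] = true
isPAP (a ∷ []) = true
isPAP (a ∷ b ∷ rest) = not ((a % 2) ≡ᵇ (b % 2)) ∧ isPAP (b ∷ rest)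

-- exactly j ascents (j an integer; never true for j < 0)
hasAsc : ℤ → List ℕ → Bool
hasAsc j w = ⌊ (+ ascents w) ℤ.≟ j ⌋

B C D : ℕ → ℤ → ℤ
B N j = + countᵇ (λ w → hasAsc j w ∧ isEvenPerm w) (perms N)
C N j = + countᵇ (λ w → hasAsc j w ∧ not (isEvenPerm w)) (perms N)
D N j = B N j - C N j

S P Q R : ℕ → ℤ → ℤ
S N j = + countᵇ (λ w → hasAsc j w ∧ isPAP w) (perms N)
P N j = + countᵇ (λ w → hasAsc j w ∧ isPAP w ∧ isEvenPerm w) (perms N)
Q N j = + countᵇ (λ w → hasAsc j w ∧ isPAP w ∧ not (isEvenPerm w)) (perms N)
R N j = P N j - Q N j

{-# OPTIONS --safe #-}
-- Prepending 0 turns a permutation w of [n-1] with k-1 ascents into a circular arrangement c of ℤ/n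
-- with k cyclic ascents, and rotating c and then subtracting its new first entry from every entry
-- (mod n) defines a map ρ with ρ^n = id.  It preserves the number of ascents; as n is even, it also
-- preserves the parity-alternate permutations and the signs of these.  For q = p^m the map ρ^(n/q)
-- generates a free action of ℤ/q once p divides k: an arrangement fixed by ρ^u lifts to an additive
-- function on the multiples of u, and if p u ≡ 0 (mod n) this forces c(u) = 0, so n ∣ u.  Hence q
-- divides S, P and Q, and therefore R = P - Q.
--
-- The sign is not invariant under ρ outside the parity-alternate permutations, so D is computed
-- instead.  Refining the signed Eulerian polynomial by the first letter gives a linear recursion
-- whose solution yields, for n = 2r,  t Σ_j D_{n-1,j} t^j = ± (1-t)^n Σ_x x^r t^x.  Modulo q ∣ n,
-- multiplication by (1-t)^n commutes with the operator f(x) ↦ x f(x), so the coefficient at k is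
-- congruent to k^m times an integer (m ≤ r), hence to 0.
module Submission where

open import Defs
open import Data.Bool using (Bool; true; false; T; not; _∧_; _xor_; if_then_else_)
open import Data.Bool.Properties using (T?; T-∧; T-≡; not-involutive; xor-assoc; xor-identityʳ; xor-same)
open import Data.Bool.Solver using (module xor-∧-Solver)
open import Data.Integer using (ℤ; 0ℤ; 1ℤ; -1ℤ; -_; _-_) renaming (_+_ to _+ᶻ_)
import Data.Integer as ℤ
open import Data.Integer.Divisibility using (_∣_)
import Data.Integer.Divisibility.Signed as Signed
open Signed using () renaming (_∣_ to _∣ᶻ_)
import Data.Integer.Properties as ℤ
import Data.Integer.Tactic.RingSolver as ℤSolver
open import Data.List using (List; []; _∷_; [_]; _++_; applyUpTo; cartesianProductWith; concatMap; drop; filter; length; map; take; upTo)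
open import Data.List.Membership.Propositional using (_∈_; _∉_)
import Data.List.Membership.DecPropositional as DecMembership
open import Data.List.Membership.Propositional.Properties
open import Data.List.Membership.Propositional.Properties.WithK using (unique∧set⇒bag)
open import Data.List.Properties
  using (++-assoc; ++-identityʳ; length-++; length-applyUpTo; length-map; length-take; map-++; map-cong-local; map-id; map-injective; map-upTo; map-∘; take++drop≡id; upTo-∷ʳ; ∷-injective; ∷-injectiveʳ; ≡-dec)
open import Data.List.Relation.Binary.BagAndSetEquality using (∼bag⇒↭)
open import Data.List.Relation.Binary.Permutation.Propositional using (_↭_; prep; ↭-refl; ↭-sym; ↭-trans; ↭⇒↭ₛ)
open import Data.List.Relation.Binary.Permutation.Propositional.Properties using (All-resp-↭; filter-↭; ↭-length; ∈-resp-↭; ∷↭∷ʳ)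
import Data.List.Relation.Binary.Permutation.Setoid.Properties as Permutation
open import Data.List.Relation.Unary.All using (All; []; _∷_)
import Data.List.Relation.Unary.All as All
import Data.List.Relation.Unary.All.Properties as All
open import Data.List.Relation.Unary.AllPairs using ([]; _∷_)
open import Data.List.Relation.Unary.Any using (here; there)
open import Data.List.Relation.Unary.Unique.Propositional using (Unique)
import Data.List.Relation.Unary.Unique.Propositional.Properties as Unique
open import Data.Nat
  using (ℕ; zero; suc; pred; _+_; _*_; _∸_; _^_; _/_; _%_; _≤_; _<_; z≤n; s≤s; s≤s⁻¹; s<s; _<ᵇ_; _≡ᵇ_; _<?_; _≟_; NonZero; >-nonZero; ≢-nonZero; nonTrivial⇒n>1)
open import Data.Nat.DivMod using (m≡m%n+[m/n]*n; m%n<n)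
open import Data.Nat.Divisibility
  using (_∤_; _∣?_; _∣0; divides; quotient; *-cancelʳ-∣; *-pres-∣; >⇒∤; m%n≡0⇒n∣m; m∣m*n; ∣-refl; ∣m∣n⇒∣m+n; ∣m+n∣m⇒∣n; ∣⇒≤) renaming (_∣_ to _∣ℕ_)
open import Data.Nat.GeneralisedArithmetic using (iterate)
open import Data.Nat.Primality using (Prime; prime⇒nonTrivial; prime⇒nonZero)
open import Data.Nat.Properties hiding (_≟_; _<?_)
import Data.Nat.Tactic.RingSolver as ℕSolver
open import Data.Product using (_×_; _,_; proj₁; proj₂; ∃)
open import Data.Sum using ([_,_]′)
open import Function using (_∘_; id; Equivalence; mk⇔)
open import Relation.Binary using (DecidableEquality)
open import Relation.Binary.PropositionalEquality hiding ([_])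
open import Relation.Nullary using (yes; no; contradiction)
open import Relation.Nullary.Decidable using (⌊_⌋; toWitness; ¬?)
open ≡-Reasoning

-- Why one factor `p` of `k` suffices against `q = p^m`: if some `w` is fixed by a nontrivial power
-- of `ρ^(n/q)`, raising that power to a suitable power of `p` gives an exponent `u` with `n ∤ u`
-- but `n ∣ p u`. Only the relation `p u ≡ 0` enters the lifting argument, so only divisibility by
-- `p` is asked of the number of cyclic ascents. Why parity alternation protects the sign: moving 0
-- to the end creates `n-1` inversions, and subtracting the first entry `a` modulo `n` reverses
-- exactly the `a(n-a)` pairs with one entry below `a` and the other not. For even `n` the sign
-- changes by `(-1)^(1+a)`, and a PAP of odd length starts with an odd `a`. Origin of the closed
-- form for `D`: the products `(x+1)^i x^(r-i)` are discrete antiderivatives of those of degree one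
-- less, so prefix sums over the first letter telescope, and `t Σ (x+1)^r t^x = Σ x^r t^x` matches
-- the two ends of the range of letters. The bound `m ≤ r` comes from `p^m ≤ 2r` and `r < 2^r`.

unique⇒↭ : {A : Set} {xs ys : List A} → Unique xs → Unique ys →
           (∀ {x} → x ∈ xs → x ∈ ys) → (∀ {x} → x ∈ ys → x ∈ xs) → xs ↭ ys
unique⇒↭ uxs uys to from = ∼bag⇒↭ (unique∧set⇒bag uxs uys (mk⇔ to from))

filterᵇ≡filter : {A : Set} (f : A → Bool) (xs : List A) → filterᵇ f xs ≡ filter (T? ∘ f) xs
filterᵇ≡filter f []       = refl
filterᵇ≡filter f (x ∷ xs) with f x
... | true  = cong (x ∷_) (filterᵇ≡filter f xs)
... | false = filterᵇ≡filter f xs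

-- Permutations as words

letters : ℕ → List ℕ
letters N = map suc (upTo N)

letters-unique : ∀ N → Unique (letters N)
letters-unique N = Unique.map⁺ suc-injective (Unique.upTo⁺ N)

∈-letters⁺ : ∀ {N a} → a < N → suc a ∈ letters N
∈-letters⁺ = ∈-map⁺ suc ∘ ∈-upTo⁺

∈-letters⁻ : ∀ {N a} → a ∈ letters N → ∃ λ b → a ≡ suc b × b < N
∈-letters⁻ a∈ with b , b∈ , eq ← ∈-map⁻ suc a∈ = b , eq , ∈-upTo⁻ b∈

words-suc : ∀ N L → words N (suc L) ≡ cartesianProductWith (λ w a → a ∷ w) (words N L) (letters N)
words-suc N L = go (words N L)
  where
  go : ∀ ws → concatMap (λ w → map (λ a → a ∷ w) (letters N)) ws ≡ cartesianProductWith (λ w a → a ∷ w) ws (letters N)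
  go []       = refl
  go (w ∷ ws) = cong (map (_∷ w) (letters N) ++_) (go ws)

words-unique : ∀ N L → Unique (words N L)
words-unique N zero    = [] ∷ []
words-unique N (suc L) = subst Unique (sym (words-suc N L))
  (Unique.cartesianProductWith⁺ _ (λ eq → let (a≡b , v≡w) = ∷-injective eq in v≡w , a≡b)
    (words-unique N L) (letters-unique N))

∈-words⁺ : ∀ {N w} → All (_∈ letters N) w → w ∈ words N (length w)
∈-words⁺             []        = here refl
∈-words⁺ {N} {a ∷ w} (a∈ ∷ w∈) = subst (a ∷ w ∈_) (sym (words-suc N (length w)))
  (∈-cartesianProductWith⁺ (λ w a → a ∷ w) (∈-words⁺ w∈) a∈)

∈-words⁻ : ∀ {N} L {w} → w ∈ words N L → length w ≡ L × All (_∈ letters N) w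
∈-words⁻         zero    (here refl) = refl , []
∈-words⁻ {N} (suc L) w∈
  with v , a , v∈ , a∈ , refl ← ∈-cartesianProductWith⁻ (λ w a → a ∷ w) (words N L) (letters N)
                                  (subst (_ ∈_) (words-suc N L) w∈)
  with len , all ← ∈-words⁻ L v∈ = cong suc len , a∈ ∷ all

notIn⇒All≢ : ∀ a bs → T (notIn a bs) → All (a ≢_) bs
notIn⇒All≢ a []       _ = []
notIn⇒All≢ a (b ∷ bs) t with a ≡ᵇ b in eq
... | false = (λ a≡b → subst T eq (≡⇒≡ᵇ a b a≡b)) ∷ notIn⇒All≢ a bs t

All≢⇒notIn : ∀ {a bs} → All (a ≢_) bs → T (notIn a bs)
All≢⇒notIn                 []          = _
All≢⇒notIn {a} {b ∷ bs} (a≢b ∷ a≢bs) with a ≡ᵇ b in eq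
... | true  = contradiction (≡ᵇ⇒≡ a b (subst T (sym eq) _)) a≢b
... | false = All≢⇒notIn a≢bs

distinct⇒Unique : ∀ w → T (distinct w) → Unique w
distinct⇒Unique []      _ = []
distinct⇒Unique (a ∷ w) t = let (t₁ , t₂) = Equivalence.to T-∧ t in
  notIn⇒All≢ a w t₁ ∷ distinct⇒Unique w t₂

Unique⇒distinct : ∀ {w} → Unique w → T (distinct w)
Unique⇒distinct []       = _
Unique⇒distinct (a∉ ∷ u) = Equivalence.from T-∧ (All≢⇒notIn a∉ , Unique⇒distinct u)

record IsPerm (N : ℕ) (w : List ℕ) : Set where
  constructor isPerm
  field
    len  : length w ≡ N
    all∈ : All (_∈ letters N) w
    uniq : Unique w

∈-perms⁺ : ∀ {N w} → IsPerm N w → w ∈ perms N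
∈-perms⁺ {N} {w} (isPerm refl all u) = subst (w ∈_) (sym (filterᵇ≡filter distinct (words N N)))
  (∈-filter⁺ (T? ∘ distinct) (∈-words⁺ all) (Unique⇒distinct u))

∈-perms⁻ : ∀ {N w} → w ∈ perms N → IsPerm N w
∈-perms⁻ {N} {w} w∈
  with w∈′ , t ← ∈-filter⁻ (T? ∘ distinct) (subst (w ∈_) (filterᵇ≡filter distinct (words N N)) w∈)
  with len , all ← ∈-words⁻ N w∈′ = isPerm len all (distinct⇒Unique w t)

perms-unique : ∀ N → Unique (perms N)
perms-unique N = subst Unique (sym (filterᵇ≡filter distinct (words N N)))
  (Unique.filter⁺ (T? ∘ distinct) (words-unique N N))

-- Decomposition of permutations by their first letter

skip : ℕ → ℕ → ℕ
skip zero    x       = suc x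
skip (suc a) zero    = zero
skip (suc a) (suc x) = suc (skip a x)

skip-injective : ∀ a {x y} → skip a x ≡ skip a y → x ≡ y
skip-injective zero    eq = suc-injective eq
skip-injective (suc a) {zero}  {zero}  eq = refl
skip-injective (suc a) {suc x} {suc y} eq = cong suc (skip-injective a (suc-injective eq))

skip-≢ : ∀ a x → a ≢ skip a x
skip-≢ (suc a) (suc x) eq = skip-≢ a x (suc-injective eq)

skip-< : ∀ a {x N} → x < N → skip a x < suc N
skip-< zero    x<N = s<s x<N
skip-< (suc a) {zero}  x<N = s≤s z≤n
skip-< (suc a) {suc x} (s<s x<N) = s<s (skip-< a x<N)

skip-surjective : ∀ a {y N} → a < suc N → y < suc N → a ≢ y → ∃ λ x → x < N × y ≡ skip a x
skip-surjective zero    {zero}  _ _ a≢y = contradiction refl a≢y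
skip-surjective zero    {suc y} _ (s<s y<N) _ = y , y<N , refl
skip-surjective (suc a) {zero}  {zero}  (s<s ()) _ _
skip-surjective (suc a) {zero}  {suc N} _ _ _ = zero , s≤s z≤n , refl
skip-surjective (suc a) {suc y} {suc N} (s<s a<) (s<s y<) a≢y
  with x , x<N , eq ← skip-surjective a a< y< (a≢y ∘ cong suc) = suc x , s<s x<N , cong suc eq

-- `skip a` enumerates the numbers other than `a` in increasing order, so the relabelled tail keeps
-- its ascents and inversions.
insert : ℕ → List ℕ → List ℕ
insert a v = a ∷ map (skip a) v

insert-injective : ∀ {a b v w} → insert a v ≡ insert b w → a ≡ b × v ≡ w
insert-injective {a} eq with refl , eq′ ← ∷-injective eq = refl , map-injective (skip-injective a) eq′

perms-suc : ∀ N → perms (suc N) ↭ cartesianProductWith insert (letters (suc N)) (perms N)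
perms-suc N = unique⇒↭ (perms-unique (suc N))
  (Unique.cartesianProductWith⁺ insert insert-injective (letters-unique (suc N)) (perms-unique N)) to from
  where
  unskip : ∀ {a as} → a < suc N → All (_∈ letters (suc N)) as → All (suc a ≢_) as → Unique as →
           ∃ λ v → as ≡ map (skip (suc a)) v × All (_∈ letters N) v × Unique v
  unskip a< [] [] [] = [] , refl , [] , []
  unskip {a} a< (b∈ ∷ bs∈) (a≢b ∷ a≢bs) (b∉bs ∷ ubs)
    with b , refl , b< ← ∈-letters⁻ b∈
    with v , refl , v∈ , uv ← unskip a< bs∈ a≢bs ubs
    with x , x< , refl ← skip-surjective a a< b< (a≢b ∘ cong suc)
    = suc x ∷ v , refl , ∈-letters⁺ x< ∷ v∈ , All.map (λ ne eq → ne (cong (skip (suc a)) eq)) (All.map⁻ b∉bs) ∷ uv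

  to : ∀ {w} → w ∈ perms (suc N) → w ∈ cartesianProductWith insert (letters (suc N)) (perms N)
  to {w} w∈ with ∈-perms⁻ {suc N} {w} w∈
  ... | isPerm len (a∈ ∷ as∈) (a∉as ∷ uas)
    with a , refl , a< ← ∈-letters⁻ {suc N} a∈
    with v , refl , v∈ , uv ← unskip a< as∈ a∉as uas
    = ∈-cartesianProductWith⁺ insert a∈
        (∈-perms⁺ (isPerm (trans (sym (length-map _ v)) (suc-injective len)) v∈ uv))

  from : ∀ {w} → w ∈ cartesianProductWith insert (letters (suc N)) (perms N) → w ∈ perms (suc N)
  from w∈ with a , v , a∈ , v∈ , refl ← ∈-cartesianProductWith⁻ insert (letters (suc N)) (perms N) w∈
          with a , refl , a< ← ∈-letters⁻ {suc N} a∈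
          with isPerm len all u ← ∈-perms⁻ {N} v∈
    = ∈-perms⁺ (isPerm (cong suc (trans (length-map _ v) len))
        (a∈ ∷ All.map⁺ (All.map (λ x∈ → let (x , eq , x<) = ∈-letters⁻ x∈ in
           subst (λ y → skip (suc a) y ∈ letters (suc N)) (sym eq) (∈-letters⁺ (skip-< a x<))) all))
        (All.map⁺ (All.tabulate (λ {x} _ → skip-≢ (suc a) x)) ∷ Unique.map⁺ (skip-injective (suc a)) u))

perm-uncons : ∀ {N w} → IsPerm (suc N) w →
              ∃ λ a → ∃ λ v → a < suc N × IsPerm N v × w ≡ insert (suc a) v
perm-uncons {N} w-perm
  with a , v , a∈ , v∈ , refl ← ∈-cartesianProductWith⁻ insert (letters (suc N)) (perms N)
                                  (∈-resp-↭ (perms-suc N) (∈-perms⁺ w-perm))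
  with a , refl , a< ← ∈-letters⁻ a∈ = a , v , a< , ∈-perms⁻ v∈ , refl

-- Free cyclic actions

iterate-+ : {A : Set} (g : A → A) (x : A) (i j : ℕ) → iterate g x (i + j) ≡ iterate g (iterate g x i) j
iterate-+ g x zero    j = refl
iterate-+ g x (suc i) j = iterate-+ g (g x) i j

iterate-suc : {A : Set} (g : A → A) (x : A) (i : ℕ) → iterate g x (suc i) ≡ g (iterate g x i)
iterate-suc g x i = trans (cong (iterate g x) (sym (+-comm i 1))) (iterate-+ g x i 1)

-- The orbit of the head has exactly `suc q` elements and its complement is again closed under `g`,
-- so orbits can be removed one at a time. The complement is not a sublist that structural recursion
-- would recognise; a bound on the length serves as the recursion argument.
free⇒∣length : {A : Set} → DecidableEquality A → (g : A → A) (q : ℕ) (xs : List A) → Unique xs →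
               (∀ {x} → x ∈ xs → g x ∈ xs) →
               (∀ {x} → x ∈ xs → iterate g x (suc q) ≡ x) →
               (∀ {x i} → x ∈ xs → 0 < i → i < suc q → iterate g x i ≢ x) →
               suc q ∣ℕ length xs
free⇒∣length {A} _≟_ g q xs = go (length xs) xs ≤-refl
  where
  open DecMembership _≟_ using (_∈?_)

  go : ∀ fuel xs → length xs ≤ fuel → Unique xs →
       (∀ {x} → x ∈ xs → g x ∈ xs) →
       (∀ {x} → x ∈ xs → iterate g x (suc q) ≡ x) →
       (∀ {x i} → x ∈ xs → 0 < i → i < suc q → iterate g x i ≢ x) →
       suc q ∣ℕ length xs
  go _ [] _ _ _ _ _ = suc q ∣0
  go (suc fuel) xs@(x ∷ _) len≤ uxs closed period free =
    subst (suc q ∣ℕ_) (sym xs-length) (∣m∣n⇒∣m+n ∣-refl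
      (go fuel rest rest≤ rest-unique rest-closed (period ∘ rest⊆) (free ∘ rest⊆)))
    where
    power : ℕ → A
    power = iterate g x

    orbit rest : List A
    orbit = applyUpTo power (suc q)
    rest  = filter (λ y → ¬? (y ∈? orbit)) xs

    power∈ : ∀ i → power i ∈ xs
    power∈ zero    = here refl
    power∈ (suc i) = subst (_∈ xs) (sym (iterate-suc g x i)) (closed (power∈ i))

    power-≢ : ∀ {i j} → i < j → j < suc q → power i ≢ power j
    power-≢ {i} {j} i<j j<q eq = free (power∈ i) (m<n⇒0<n∸m i<j) (≤-<-trans (m∸n≤m j i) j<q)
      (trans (sym (iterate-+ g x i (j ∸ i))) (trans (cong power (m+[n∸m]≡n (<⇒≤ i<j))) (sym eq)))

    orbit-unique : Unique orbit
    orbit-unique = Unique.applyUpTo⁺₁ power (suc q) power-≢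

    rest-unique : Unique rest
    rest-unique = Unique.filter⁺ (λ y → ¬? (y ∈? orbit)) uxs

    ∈-rest⁻ : ∀ {y} → y ∈ rest → y ∈ xs × y ∉ orbit
    ∈-rest⁻ = ∈-filter⁻ (λ y → ¬? (y ∈? orbit))

    rest⊆ : ∀ {y} → y ∈ rest → y ∈ xs
    rest⊆ = proj₁ ∘ ∈-rest⁻

    orbit⊆ : ∀ {y} → y ∈ orbit → y ∈ xs
    orbit⊆ y∈ with i , _ , refl ← ∈-applyUpTo⁻ power y∈ = power∈ i

    g-injective : ∀ {y z} → y ∈ xs → z ∈ xs → g y ≡ g z → y ≡ z
    g-injective y∈ z∈ eq = trans (sym (period y∈)) (trans (cong (λ u → iterate g u q) eq) (period z∈))

    unorbit : ∀ {y} → y ∈ xs → g y ∈ orbit → y ∈ orbit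
    unorbit {y} y∈ gy∈ with ∈-applyUpTo⁻ power gy∈
    -- Here `g y` is the starting point `x`, which by periodicity is also `g (power q)`; injectivity
    -- then places `y` at the end of the orbit.
    ... | zero  , _ , eq = subst (_∈ orbit)
      (sym (g-injective y∈ (power∈ q) (trans eq (trans (sym (period (here refl))) (iterate-suc g x q)))))
      (∈-applyUpTo⁺ power (n<1+n q))
    ... | suc i , i< , eq = subst (_∈ orbit)
      (sym (g-injective y∈ (power∈ i) (trans eq (iterate-suc g x i))))
      (∈-applyUpTo⁺ power (<-trans (n<1+n i) i<))

    rest-closed : ∀ {y} → y ∈ rest → g y ∈ rest
    rest-closed y∈ = let (y∈xs , y∉) = ∈-rest⁻ y∈ in
      ∈-filter⁺ (λ y → ¬? (y ∈? orbit)) (closed y∈xs) (y∉ ∘ unorbit y∈xs)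

    split : xs ↭ orbit ++ rest
    split = unique⇒↭ uxs
      (Unique.++⁺ orbit-unique rest-unique (λ (y∈o , y∈r) → proj₂ (∈-rest⁻ y∈r) y∈o))
      to ([ orbit⊆ , rest⊆ ]′ ∘ ∈-++⁻ orbit)
      where
      to : ∀ {y} → y ∈ xs → y ∈ orbit ++ rest
      to {y} y∈ with y ∈? orbit
      ... | yes y∈o = ∈-++⁺ˡ y∈o
      ... | no  y∉o = ∈-++⁺ʳ orbit (∈-filter⁺ (λ y → ¬? (y ∈? orbit)) y∈ y∉o)

    xs-length : length xs ≡ suc q + length rest
    xs-length = trans (↭-length split) (trans (length-++ orbit) (cong (_+ length rest) (length-applyUpTo power (suc q))))

    rest≤ : length rest ≤ fuel
    rest≤ = s≤s⁻¹ (≤-trans (s≤s (m≤n+m _ q)) (subst (_≤ suc fuel) xs-length len≤))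

-- Rotation of circular words

lt : ℕ → ℕ → ℕ
lt a b = if a <ᵇ b then 1 else 0

lt-< : ∀ {a b} → a < b → lt a b ≡ 1
lt-< {a} {b} a<b with a <ᵇ b | <⇒<ᵇ a<b
... | true | _ = refl

lt-≥ : ∀ {a b} → b ≤ a → lt a b ≡ 0
lt-≥ {a} {b} b≤a with a <ᵇ b in eq
... | true  = contradiction (<ᵇ⇒< a b (subst T (sym eq) _)) (≤⇒≯ b≤a)
... | false = refl

-- Residues modulo `n` and the wrap indicator

≡-mod-< : ∀ {n x y i j} → x < n → y < n → x + n * i ≡ y + n * j → x ≡ y
≡-mod-< {n} {x} {y} {zero}  {zero}  x< y< eq = subst₂ _≡_ (lemma x) (lemma y) eq
  where
  lemma : ∀ z → z + n * 0 ≡ z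
  lemma z = trans (cong (z +_) (*-zeroʳ n)) (+-identityʳ z)
≡-mod-< {n} {x} {y} {zero}  {suc j} x< y< eq = contradiction
  (subst (n ≤_) (trans (sym eq) (trans (cong (x +_) (*-zeroʳ n)) (+-identityʳ x)))
    (≤-trans (m≤m*n n (suc j)) (m≤n+m _ y))) (<⇒≱ x<)
≡-mod-< {n} {x} {y} {suc i} {zero}  x< y< eq = contradiction
  (subst (n ≤_) (trans eq (trans (cong (y +_) (*-zeroʳ n)) (+-identityʳ y)))
    (≤-trans (m≤m*n n (suc i)) (m≤n+m _ x))) (<⇒≱ y<)
≡-mod-< {n} {x} {y} {suc i} {suc j} x< y< eq = ≡-mod-< {i = i} {j} x< y< (+-cancelˡ-≡ n _ _
  (trans (shuffle n x i) (trans eq (sym (shuffle n y j)))))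
  where
  shuffle : ∀ n z k → n + (z + n * k) ≡ z + n * suc k
  shuffle = ℕSolver.solve-∀

module Circle (n : ℕ) where

  -- (b - a) mod n
  shift : ℕ → ℕ → ℕ
  shift a b = b + n * lt b a ∸ a

  shift-< : ∀ {a b} → b < a → shift a b ≡ b + n ∸ a
  shift-< {a} {b} b<a = cong (λ h → b + h ∸ a) (trans (cong (n *_) (lt-< b<a)) (*-identityʳ n))

  shift-≥ : ∀ {a b} → a ≤ b → shift a b ≡ b ∸ a
  shift-≥ {a} {b} a≤b = cong (_∸ a)
    (trans (cong (b +_) (trans (cong (n *_) (lt-≥ a≤b)) (*-zeroʳ n))) (+-identityʳ b))

  shift-+ : ∀ {a} b → a < n → shift a b + a ≡ b + n * lt b a
  shift-+ {a} b a<n with b <? a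
  ... | yes b<a rewrite lt-< b<a | *-identityʳ n = m∸n+n≡m (≤-trans (<⇒≤ a<n) (m≤n+m n b))
  ... | no  b≮a rewrite lt-≥ (≮⇒≥ b≮a) | *-zeroʳ n | +-identityʳ b = m∸n+n≡m (≮⇒≥ b≮a)

  shift-bound : ∀ {a b} → a < n → b < n → shift a b < n
  shift-bound {a} {b} a<n b<n with b <? a
  ... | yes b<a rewrite shift-< b<a = +-cancelʳ-< a (b + n ∸ a) n
    (subst₂ _<_ (sym (m∸n+n≡m (≤-trans (<⇒≤ a<n) (m≤n+m n b)))) (+-comm a n) (+-monoˡ-< n b<a))
  ... | no  b≮a rewrite shift-≥ (≮⇒≥ b≮a) = ≤-<-trans (m∸n≤m b a) b<n

  shift-self : ∀ a → shift a a ≡ 0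
  shift-self a = trans (shift-≥ {a} {a} ≤-refl) (n∸n≡0 a)

  shift-0 : ∀ b → shift 0 b ≡ b
  shift-0 b = shift-≥ {0} {b} z≤n

  shift-injective : ∀ {a b c} → a < n → b < n → c < n → shift a b ≡ shift a c → b ≡ c
  shift-injective {a} {b} {c} a< b< c< eq = ≡-mod-< {i = lt b a} {lt c a} b< c<
    (trans (sym (shift-+ b a<)) (trans (cong (_+ a) eq) (shift-+ c a<)))

  shift-shift : ∀ {a b x} → a < n → b < n → x < n → shift (shift a b) (shift a x) ≡ shift b x
  shift-shift {a} {b} {x} a< b< x< =
    -- Each `shift` is a subtraction plus one multiple of `n` if it wraps; the implicit arguments
    -- collect the wraps of the two sides.
    ≡-mod-< {i = lt b a + lt x b} {lt (shift a x) (shift a b) + lt x a}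
      (shift-bound (shift-bound a< b<) (shift-bound a< x<)) (shift-bound b< x<)
      (+-cancelʳ-≡ b _ _ (begin
        z + n * (lt b a + lt x b) + b                       ≡⟨ r₁ z n (lt b a) (lt x b) b ⟩
        z + (b + n * lt b a) + n * lt x b                   ≡⟨ cong (λ t → z + t + n * lt x b) (sym (shift-+ b a<)) ⟩
        z + (shift a b + a) + n * lt x b                    ≡⟨ r₂ z (shift a b) a (n * lt x b) ⟩
        (z + shift a b) + a + n * lt x b                    ≡⟨ cong (λ t → t + a + n * lt x b) (shift-+ (shift a x) (shift-bound a< b<)) ⟩
        (shift a x + n * h) + a + n * lt x b                ≡⟨ r₃ (shift a x) (n * h) a (n * lt x b) ⟩
        (shift a x + a) + n * h + n * lt x b                ≡⟨ cong (λ t → t + n * h + n * lt x b) (shift-+ x a<) ⟩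
        (x + n * lt x a) + n * h + n * lt x b               ≡⟨ r₄ x n (lt x a) h (lt x b) ⟩
        (x + n * lt x b) + n * (h + lt x a)                 ≡⟨ cong (_+ n * (h + lt x a)) (sym (shift-+ x b<)) ⟩
        (shift b x + b) + n * (h + lt x a)                  ≡⟨ r₃′ (shift b x) b (n * (h + lt x a)) ⟩
        shift b x + n * (h + lt x a) + b                    ∎))
    where
    z = shift (shift a b) (shift a x)
    h = lt (shift a x) (shift a b)
    r₁ : ∀ z n s t b → z + n * (s + t) + b ≡ z + (b + n * s) + n * t
    r₁ = ℕSolver.solve-∀
    r₂ : ∀ z s a t → z + (s + a) + t ≡ z + s + a + t
    r₂ = ℕSolver.solve-∀
    r₃ : ∀ s h a t → s + h + a + t ≡ s + a + h + t
    r₃ = ℕSolver.solve-∀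
    r₃′ : ∀ s b t → s + b + t ≡ s + t + b
    r₃′ = ℕSolver.solve-∀
    r₄ : ∀ x n s h t → x + n * s + n * h + n * t ≡ x + n * t + n * (h + s)
    r₄ = ℕSolver.solve-∀

  -- `lt b a` tells whether `b` wraps under `shift a`. Shifting by a constant thus changes the
  -- comparison of `b` with `c` only by a difference of wraps. Summed along a closed walk the
  -- differences telescope, which controls ascents; summed over the letters of a word they control
  -- inversions.
  lt-shift : ∀ {a b c} → a < n → b < n → c < n →
             lt (shift a b) (shift a c) + lt b a ≡ lt b c + lt c a
  lt-shift {a} {b} {c} a< b< c< with b <? a | c <? a
  ... | yes b<a | yes c<a rewrite shift-< b<a | shift-< c<a | lt-< b<a | lt-< c<a with b <? c
  ...   | yes b<c rewrite lt-< b<c = cong (_+ 1) (lt-< (∸-monoˡ-< (+-monoˡ-< n b<c) (≤-trans (<⇒≤ a<) (m≤n+m n b))))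
  ...   | no  b≮c rewrite lt-≥ (≮⇒≥ b≮c) = cong (_+ 1) (lt-≥ (∸-monoˡ-≤ a (+-monoˡ-≤ n (≮⇒≥ b≮c))))
  lt-shift {a} {b} {c} a< b< c< | yes b<a | no c≮a
    rewrite shift-< b<a | shift-≥ (≮⇒≥ c≮a) | lt-< b<a | lt-≥ (≮⇒≥ c≮a) | lt-< (<-≤-trans b<a (≮⇒≥ c≮a))
    = cong (_+ 1) (lt-≥ (∸-monoˡ-≤ a (≤-trans (<⇒≤ c<) (m≤n+m n b))))
  lt-shift {a} {b} {c} a< b< c< | no b≮a | yes c<a
    rewrite shift-≥ (≮⇒≥ b≮a) | shift-< c<a | lt-≥ (≮⇒≥ b≮a) | lt-< c<a | lt-≥ (≤-trans (<⇒≤ c<a) (≮⇒≥ b≮a))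
    = cong (_+ 0) (lt-< (∸-monoˡ-< (<-≤-trans b< (m≤n+m n c)) (≮⇒≥ b≮a)))
  lt-shift {a} {b} {c} a< b< c< | no b≮a | no c≮a
    rewrite shift-≥ (≮⇒≥ b≮a) | shift-≥ (≮⇒≥ c≮a) | lt-≥ (≮⇒≥ b≮a) | lt-≥ (≮⇒≥ c≮a) with b <? c
  ... | yes b<c rewrite lt-< b<c = cong (_+ 0) (lt-< (∸-monoˡ-< b<c (≮⇒≥ b≮a)))
  ... | no  b≮c rewrite lt-≥ (≮⇒≥ b≮c) = cong (_+ 0) (lt-≥ (∸-monoˡ-≤ a (≮⇒≥ b≮c)))

-- Rotation of lists and cyclic ascents

rotate : List ℕ → List ℕ
rotate []       = []
rotate (x ∷ xs) = xs ++ [ x ]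

-- Only ever applied to nonempty lists; the value at [] is junk.
first : List ℕ → ℕ
first []      = 0
first (x ∷ _) = x

rotate-map : ∀ (f : ℕ → ℕ) l → rotate (map f l) ≡ map f (rotate l)
rotate-map f []       = refl
rotate-map f (x ∷ xs) = sym (map-++ f xs [ x ])

rotate^-map : ∀ (f : ℕ → ℕ) l i → iterate rotate (map f l) i ≡ map f (iterate rotate l i)
rotate^-map f l zero    = refl
rotate^-map f l (suc i) = trans (cong (λ m → iterate rotate m i) (rotate-map f l)) (rotate^-map f (rotate l) i)

rotate-↭ : ∀ l → l ↭ rotate l
rotate-↭ []       = ↭-refl
rotate-↭ (x ∷ xs) = ∷↭∷ʳ x xs

rotate^-↭ : ∀ l i → l ↭ iterate rotate l i
rotate^-↭ l zero    = ↭-refl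
rotate^-↭ l (suc i) = ↭-trans (rotate-↭ l) (rotate^-↭ (rotate l) i)

rotate^-++ : ∀ xs ys → iterate rotate (xs ++ ys) (length xs) ≡ ys ++ xs
rotate^-++ []       ys = sym (++-identityʳ ys)
rotate^-++ (x ∷ xs) ys = begin
  iterate rotate ((xs ++ ys) ++ [ x ]) (length xs) ≡⟨ cong (λ l → iterate rotate l (length xs)) (++-assoc xs ys [ x ]) ⟩
  iterate rotate (xs ++ (ys ++ [ x ])) (length xs) ≡⟨ rotate^-++ xs (ys ++ [ x ]) ⟩
  (ys ++ [ x ]) ++ xs                              ≡⟨ ++-assoc ys [ x ] xs ⟩
  ys ++ x ∷ xs                                     ∎

rotate^-length : ∀ l → iterate rotate l (length l) ≡ l
rotate^-length l = trans (cong (λ m → iterate rotate m (length l)) (sym (++-identityʳ l))) (rotate^-++ l [])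

rotate^-* : ∀ l v → iterate rotate l (v * length l) ≡ l
rotate^-* l zero    = refl
rotate^-* l (suc v) = trans (iterate-+ rotate l (length l) (v * length l))
  (trans (cong (λ m → iterate rotate m (v * length l)) (rotate^-length l)) (rotate^-* l v))

first-map : ∀ (f : ℕ → ℕ) {l} → 0 < length l → first (map f l) ≡ f (first l)
first-map f {x ∷ _} _ = refl

-- The number of ascents in the first `i` cyclic steps from the head. Since it reads first entries
-- of successive rotations, `i` may exceed the length and the walk goes round again;
-- `walk (length l) l` counts the cyclic ascents.
walk : ℕ → List ℕ → ℕ
walk zero    l = 0
walk (suc i) l = lt (first l) (first (rotate l)) + walk i (rotate l)

walk-+ : ∀ i j l → walk (i + j) l ≡ walk i l + walk j (iterate rotate l i)
walk-+ zero    j l = refl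
walk-+ (suc i) j l = trans (cong (lt (first l) (first (rotate l)) +_) (walk-+ i j (rotate l)))
  (sym (+-assoc (lt (first l) (first (rotate l))) _ _))

walk-* : ∀ v l → walk (v * length l) l ≡ v * walk (length l) l
walk-* zero    l = refl
walk-* (suc v) l = trans (walk-+ (length l) (v * length l) l) (cong (walk (length l) l +_)
  (trans (cong (walk (v * length l)) (rotate^-length l)) (walk-* v l)))

walk-rotate : ∀ l → walk (length l) (rotate l) ≡ walk (length l) l
walk-rotate l = +-cancelˡ-≡ s _ _ (begin
  walk (suc (length l)) l                   ≡⟨ cong (λ i → walk i l) (+-comm 1 (length l)) ⟩
  walk (length l + 1) l                     ≡⟨ walk-+ (length l) 1 l ⟩
  walk (length l) l + walk 1 (iterate rotate l (length l))
                                            ≡⟨ cong (λ m → walk (length l) l + walk 1 m) (rotate^-length l) ⟩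
  walk (length l) l + (s + 0)               ≡⟨ cong (walk (length l) l +_) (+-identityʳ s) ⟩
  walk (length l) l + s                     ≡⟨ +-comm _ s ⟩
  s + walk (length l) l                     ∎)
  where s = lt (first l) (first (rotate l))

-- The last of the `length xs` steps leaves `xs`; its target is the head of `ys`, or of `xs` itself
-- if `ys` is empty.
walk-++ : ∀ xs ys → walk (length xs) (xs ++ ys) ≡ ascents (xs ++ [ first (ys ++ xs) ])
walk-++ []            ys = refl
walk-++ (x ∷ [])      ys = refl
walk-++ (x ∷ y ∷ xs) ys = cong (lt x y +_) (begin
  walk (length (y ∷ xs)) ((y ∷ xs ++ ys) ++ [ x ])  ≡⟨ cong (walk (length (y ∷ xs))) (++-assoc (y ∷ xs) ys [ x ]) ⟩
  walk (length (y ∷ xs)) (y ∷ xs ++ (ys ++ [ x ]))  ≡⟨ walk-++ (y ∷ xs) (ys ++ [ x ]) ⟩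
  ascents (y ∷ xs ++ [ first ((ys ++ [ x ]) ++ y ∷ xs) ])
    ≡⟨ cong (λ l → ascents (y ∷ xs ++ [ first l ])) (++-assoc ys [ x ] (y ∷ xs)) ⟩
  ascents (y ∷ xs ++ [ first (ys ++ x ∷ y ∷ xs) ])  ∎)

ascents-++0 : ∀ xs → ascents (xs ++ [ 0 ]) ≡ ascents xs
ascents-++0 []           = refl
ascents-++0 (x ∷ [])     = refl
ascents-++0 (x ∷ y ∷ xs) = cong (lt x y +_) (ascents-++0 (y ∷ xs))

-- The step out of 0 is always an ascent and the step back to 0 never is. For empty `w` the only
-- step is from 0 to 0, hence the hypothesis on the length.
walk-around : ∀ {w} → 0 < length w → All (0 <_) w → walk (suc (length w)) (0 ∷ w) ≡ suc (ascents w)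
walk-around {zero  ∷ _} _ (() ∷ _)
walk-around {suc b ∷ w} _ _ = begin
  walk (suc (length (suc b ∷ w))) (0 ∷ suc b ∷ w)        ≡⟨ cong (walk (suc (length (suc b ∷ w)))) (sym (++-identityʳ (0 ∷ suc b ∷ w))) ⟩
  walk (suc (length (suc b ∷ w))) ((0 ∷ suc b ∷ w) ++ []) ≡⟨ walk-++ (0 ∷ suc b ∷ w) [] ⟩
  ascents (0 ∷ suc b ∷ w ++ [ 0 ])                       ≡⟨ ascents-++0 (0 ∷ suc b ∷ w) ⟩
  suc (ascents (suc b ∷ w))                              ∎

Unique-map-local : ∀ {P : ℕ → Set} {f : ℕ → ℕ} → (∀ {x y} → P x → P y → f x ≡ f y → x ≡ y) →
                   ∀ {xs} → All P xs → Unique xs → Unique (map f xs)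
Unique-map-local inj []         []         = []
Unique-map-local inj (px ∷ pxs) (x∉ ∷ uxs) =
  All.map⁺ (All.zipWith (λ (py , x≢y) eq → x≢y (inj px py eq)) (pxs , x∉)) ∷ Unique-map-local inj pxs uxs

Unique-resp-↭ : ∀ {xs ys : List ℕ} → xs ↭ ys → Unique xs → Unique ys
Unique-resp-↭ p = Permutation.Unique-resp-↭ (setoid ℕ) (↭⇒↭ₛ p)

first-positive : ∀ {w} → All (0 <_) w → ∀ {r} → 0 < r → r < suc (length w) → 0 < first (iterate rotate (0 ∷ w) r)
first-positive {w} pos {suc r} _ (s≤s r<) = subst (λ l → 0 < first l) (sym turn) (go pos r<)
  where
  turn : iterate rotate (0 ∷ w) (suc r) ≡ drop r w ++ (0 ∷ take r w)
  turn = begin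
    iterate rotate (0 ∷ w) (suc r)
      ≡⟨ cong₂ (λ l k → iterate rotate (0 ∷ l) (suc k)) (sym (take++drop≡id r w))
           (sym (trans (length-take r w) (m≤n⇒m⊓n≡m (<⇒≤ r<)))) ⟩
    iterate rotate ((0 ∷ take r w) ++ drop r w) (length (0 ∷ take r w))
      ≡⟨ rotate^-++ (0 ∷ take r w) (drop r w) ⟩
    drop r w ++ (0 ∷ take r w) ∎
  go : ∀ {w r ys} → All (0 <_) w → r < length w → 0 < first (drop r w ++ ys)
  go {r = zero}  (0<x ∷ _)   _        = 0<x
  go {r = suc r} (_   ∷ pos) (s≤s r<) = go pos r<

first-positive′ : ∀ {w} → All (0 <_) w → ∀ {u} → suc (length w) ∤ u → 0 < first (iterate rotate (0 ∷ w) u)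
first-positive′ {w} pos {u} n∤u = subst (λ l → 0 < first l) (sym reduce)
  (first-positive pos (n≢0⇒n>0 (λ r≡0 → n∤u (m%n≡0⇒n∣m u n r≡0))) (m%n<n u n))
  where
  n = suc (length w)
  reduce : iterate rotate (0 ∷ w) u ≡ iterate rotate (0 ∷ w) (u % n)
  reduce = begin
    iterate rotate (0 ∷ w) u                                     ≡⟨ cong (iterate rotate (0 ∷ w)) (trans (m≡m%n+[m/n]*n u n) (+-comm (u % n) _)) ⟩
    iterate rotate (0 ∷ w) (u / n * n + u % n)                   ≡⟨ iterate-+ rotate (0 ∷ w) (u / n * n) (u % n) ⟩
    iterate rotate (iterate rotate (0 ∷ w) (u / n * n)) (u % n)  ≡⟨ cong (λ l → iterate rotate l (u % n)) (rotate^-* (0 ∷ w) (u / n)) ⟩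
    iterate rotate (0 ∷ w) (u % n)                               ∎

-- The map `rho`, its powers and its fixed points

module Rotation (n : ℕ) where
  open Circle n

  -- The circular word `0 ∷ a ∷ as` turns into `a ∷ as ++ [ 0 ]`; after subtracting `a` its head is
  -- 0 again, and this head is left implicit.
  rho : List ℕ → List ℕ
  rho []       = []
  rho (a ∷ as) = map (shift a) (as ++ [ 0 ])

  normalise : List ℕ → List ℕ
  normalise l = map (shift (first l)) l

  Bounded : List ℕ → Set
  Bounded = All (_< n)

  first-bounded : ∀ {l} → 0 < length l → Bounded l → first l < n
  first-bounded {x ∷ _} _ (x< ∷ _) = x<

  rotate^-bounded : ∀ i {l} → Bounded l → Bounded (iterate rotate l i)
  rotate^-bounded i = All-resp-↭ (rotate^-↭ _ i)

  rotate^-nonempty : ∀ i {l} → 0 < length l → 0 < length (iterate rotate l i)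
  rotate^-nonempty i {l} = subst (0 <_) (↭-length (rotate^-↭ l i))

  rho-normalise : ∀ w → 0 ∷ rho w ≡ normalise (rotate (0 ∷ w))
  rho-normalise []       = cong [_] (sym (shift-self 0))
  rho-normalise (a ∷ as) = cong (_∷ map (shift a) (as ++ [ 0 ])) (sym (shift-self a))

  normalise-shift : ∀ {a l} → a < n → Bounded l → 0 < length l → normalise (map (shift a) l) ≡ normalise l
  normalise-shift {a} {l@(x ∷ _)} a< l<@(x< ∷ _) _ =
    trans (sym (map-∘ l)) (map-cong-local (All.map (shift-shift a< x<) l<))

  -- By `shift-shift` successive normalisations collapse into the last one, so `i` steps of `rho`
  -- amount to one rotation by `i` places and one normalisation.
  rho^-normalise : ∀ w → Bounded (0 ∷ w) → ∀ i → 0 ∷ iterate rho w i ≡ normalise (iterate rotate (0 ∷ w) i)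
  rho^-normalise w c< zero    = sym (trans (map-cong-local (All.tabulate (λ {x} _ → shift-0 x))) (map-id (0 ∷ w)))
  rho^-normalise w c< (suc i) = begin
    0 ∷ iterate rho w (suc i)                             ≡⟨ cong (0 ∷_) (iterate-suc rho w i) ⟩
    0 ∷ rho (iterate rho w i)                             ≡⟨ rho-normalise (iterate rho w i) ⟩
    normalise (rotate (0 ∷ iterate rho w i))              ≡⟨ cong (normalise ∘ rotate) (rho^-normalise w c< i) ⟩
    normalise (rotate (normalise l))                      ≡⟨ cong normalise (rotate-map (shift (first l)) l) ⟩
    normalise (map (shift (first l)) (rotate l))          ≡⟨ normalise-shift (first-bounded l>0 l<) (rotate^-bounded 1 l<) (rotate^-nonempty 1 {l} l>0) ⟩
    normalise (rotate l)                                  ≡⟨ cong normalise (sym (iterate-suc rotate (0 ∷ w) i)) ⟩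
    normalise (iterate rotate (0 ∷ w) (suc i))            ∎
    where
    l   = iterate rotate (0 ∷ w) i
    l<  = rotate^-bounded i c<
    l>0 = rotate^-nonempty i {0 ∷ w} (s≤s z≤n)

  rho-period : ∀ w → Bounded (0 ∷ w) → suc (length w) ≡ n → iterate rho w n ≡ w
  rho-period w c< refl = ∷-injectiveʳ (begin
    0 ∷ iterate rho w n                      ≡⟨ rho^-normalise w c< n ⟩
    normalise (iterate rotate (0 ∷ w) n)     ≡⟨ cong normalise (rotate^-length (0 ∷ w)) ⟩
    normalise (0 ∷ w)                        ≡⟨ sym (rho^-normalise w c< 0) ⟩
    0 ∷ w                                    ∎)

  -- `lt-shift` telescoped along the walk: only the wraps at its two ends survive, and they agree
  -- when the walk closes up.
  walk-shift : ∀ {a} → a < n → ∀ i {l} → 0 < length l → Bounded l →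
               walk i (map (shift a) l) + lt (first l) a ≡ walk i l + lt (first (iterate rotate l i)) a
  walk-shift         a< zero    _   _  = refl
  walk-shift {a} a< (suc i) {l} l>0 l< = begin
    lt (first (map (shift a) l)) (first (rotate (map (shift a) l))) + walk i (rotate (map (shift a) l)) + lt x a
      ≡⟨ cong₂ (λ s m → s + walk i m + lt x a)
           (cong₂ lt (first-map (shift a) {l} l>0) (trans (cong first (rotate-map (shift a) l)) (first-map (shift a) {rotate l} l′>0)))
           (rotate-map (shift a) l) ⟩
    lt (shift a x) (shift a y) + walk i (map (shift a) (rotate l)) + lt x a
      ≡⟨ r (lt (shift a x) (shift a y)) (walk i (map (shift a) (rotate l))) (lt x a) ⟩
    (lt (shift a x) (shift a y) + lt x a) + walk i (map (shift a) (rotate l))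
      ≡⟨ cong (_+ walk i (map (shift a) (rotate l))) (lt-shift a< (first-bounded l>0 l<) (first-bounded l′>0 l′<)) ⟩
    (lt x y + lt y a) + walk i (map (shift a) (rotate l))
      ≡⟨ r′ (lt x y) (lt y a) (walk i (map (shift a) (rotate l))) ⟩
    lt x y + (walk i (map (shift a) (rotate l)) + lt y a)
      ≡⟨ cong (lt x y +_) (walk-shift a< i l′>0 l′<) ⟩
    lt x y + (walk i (rotate l) + lt (first (iterate rotate (rotate l) i)) a)
      ≡⟨ sym (+-assoc (lt x y) _ _) ⟩
    lt x y + walk i (rotate l) + lt (first (iterate rotate (rotate l) i)) a ∎
    where
    x    = first l
    y    = first (rotate l)
    l′>0 = rotate^-nonempty 1 {l} l>0
    l′<  = rotate^-bounded 1 l<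
    r : ∀ s t u → s + t + u ≡ s + u + t
    r = ℕSolver.solve-∀
    r′ : ∀ s t u → s + t + u ≡ s + (u + t)
    r′ = ℕSolver.solve-∀

  walk-rho : ∀ w → Bounded (0 ∷ w) → walk (suc (length w)) (0 ∷ rho w) ≡ walk (suc (length w)) (0 ∷ w)
  walk-rho w c< = begin
    walk m (0 ∷ rho w)           ≡⟨ cong (walk m) (rho-normalise w) ⟩
    walk m (map (shift a) l)     ≡⟨ +-cancelʳ-≡ (lt (first l) a) _ _ (trans (walk-shift (first-bounded l>0 l<) m l>0 l<)
                                      (cong (λ k → walk m l + lt (first k) a) (trans (cong (iterate rotate l) m-length) (rotate^-length l)))) ⟩
    walk m l                     ≡⟨ walk-rotate (0 ∷ w) ⟩
    walk m (0 ∷ w)               ∎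
    where
    m   = suc (length w)
    l   = rotate (0 ∷ w)
    a   = first l
    l<  = rotate^-bounded 1 c<
    l>0 = rotate^-nonempty 1 {0 ∷ w} (s≤s z≤n)
    m-length : m ≡ length l
    m-length = ↭-length (rotate^-↭ (0 ∷ w) 1)

  -- If rho^u fixes w, the lift i ↦ n A(i) - c(i) of the circular word c = 0 ∷ w, with A counting
  -- ascents, is additive on multiples of u.  If moreover p u = n v and p divides the number of
  -- cyclic ascents, then n divides c(u).
  fixed⇒first≡0 : ∀ w → Bounded (0 ∷ w) → suc (length w) ≡ n → ∀ {u p v e} → .{{NonZero p}} →
                  iterate rho w u ≡ w → p * u ≡ v * n → walk n (0 ∷ w) ≡ p * e →
                  first (iterate rotate (0 ∷ w) u) ≡ 0
  fixed⇒first≡0 w c< refl {u} {p} {v} {e} fix pu≡vn asc≡pe = <-∣⇒≡0 a<n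
    (∣m+n∣m⇒∣n (subst (n ∣ℕ_) nWu (m∣m*n (walk u c))) (subst (n ∣ℕ_) (*-comm n (v * e)) (m∣m*n (v * e))))
    where
    c = 0 ∷ w
    l = iterate rotate c u
    a = first l
    l<  = rotate^-bounded u c<
    l>0 = rotate^-nonempty u {c} (s≤s z≤n)
    a<n = first-bounded l>0 l<
    pos : ℕ → ℕ
    pos i = first (iterate rotate c i)

    <-∣⇒≡0 : ∀ {x} → x < n → n ∣ℕ x → x ≡ 0
    <-∣⇒≡0 {zero}  _  _   = refl
    <-∣⇒≡0 {suc x} x< n∣x = contradiction n∣x (>⇒∤ x<)

    -- The fixed-point hypothesis read on the circle: turning by `u` places adds the constant `a`
    -- modulo `n` to every entry.
    shifted : map (shift a) l ≡ c
    shifted = trans (sym (rho^-normalise w c< u)) (cong (0 ∷_) fix)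

    pos-shift : ∀ i → shift a (pos (u + i)) ≡ pos i
    pos-shift i = begin
      shift a (first (iterate rotate c (u + i)))        ≡⟨ cong (shift a ∘ first) (iterate-+ rotate c u i) ⟩
      shift a (first (iterate rotate l i))              ≡⟨ sym (first-map (shift a) {iterate rotate l i} (rotate^-nonempty i {l} l>0)) ⟩
      first (map (shift a) (iterate rotate l i))        ≡⟨ cong first (sym (rotate^-map (shift a) l i)) ⟩
      first (iterate rotate (map (shift a) l) i)        ≡⟨ cong (λ m → first (iterate rotate m i)) shifted ⟩
      first (iterate rotate c i)                        ∎

    walk-u : ∀ i → walk i c + walk u c ≡ walk (u + i) c + lt (pos (u + i)) a
    walk-u i = begin
      walk i c + walk u c                          ≡⟨ cong (λ m → walk i m + walk u c) (sym shifted) ⟩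
      walk i (map (shift a) l) + walk u c          ≡⟨ cong (_+ walk u c) (trans (sym (+-identityʳ _))
                                                        (trans (cong (walk i (map (shift a) l) +_) (sym (lt-≥ {a} {a} ≤-refl)))
                                                          (walk-shift a<n i l>0 l<))) ⟩
      walk i l + lt (first (iterate rotate l i)) a + walk u c
                                                   ≡⟨ cong (λ m → walk i l + lt (first m) a + walk u c) (sym (iterate-+ rotate c u i)) ⟩
      walk i l + lt (pos (u + i)) a + walk u c     ≡⟨ r (walk i l) (lt (pos (u + i)) a) (walk u c) ⟩
      walk u c + walk i l + lt (pos (u + i)) a     ≡⟨ cong (_+ lt (pos (u + i)) a) (sym (walk-+ u i c)) ⟩
      walk (u + i) c + lt (pos (u + i)) a          ∎
      where
      r : ∀ s t u → s + t + u ≡ u + s + t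
      r = ℕSolver.solve-∀

    -- With `L(i) = n A(i) - c(i)` this says `L(u+i) = L(u) + L(i)`; negative terms are moved across
    -- so that it can be stated in `ℕ`.
    lift-u : ∀ i → n * walk i c + n * walk u c + pos (u + i) ≡ n * walk (u + i) c + (pos i + a)
    lift-u i = begin
      n * walk i c + n * walk u c + pos (u + i)            ≡⟨ cong (_+ pos (u + i)) (sym (*-distribˡ-+ n (walk i c) (walk u c))) ⟩
      n * (walk i c + walk u c) + pos (u + i)              ≡⟨ cong (λ t → n * t + pos (u + i)) (walk-u i) ⟩
      n * (walk (u + i) c + h) + pos (u + i)               ≡⟨ r n (walk (u + i) c) h (pos (u + i)) ⟩
      n * walk (u + i) c + (pos (u + i) + n * h)           ≡⟨ cong (n * walk (u + i) c +_) (sym (shift-+ (pos (u + i)) a<n)) ⟩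
      n * walk (u + i) c + (shift a (pos (u + i)) + a)     ≡⟨ cong (λ t → n * walk (u + i) c + (t + a)) (pos-shift i) ⟩
      n * walk (u + i) c + (pos i + a)                     ∎
      where
      h = lt (pos (u + i)) a
      r : ∀ n s h t → n * (s + h) + t ≡ n * s + (t + n * h)
      r = ℕSolver.solve-∀

    -- `j L(u) = L(j u)`, again without subtraction.
    lift-* : ∀ j → j * (n * walk u c) + pos (j * u) ≡ n * walk (j * u) c + j * a
    lift-* zero    = sym (cong (_+ 0) (*-zeroʳ n))
    lift-* (suc j) = +-cancelˡ-≡ (n * walk (j * u) c + pos (j * u)) _ _ (begin
      (Y + X) + ((n * walk u c + j * (n * walk u c)) + pos (u + j * u))
        ≡⟨ r₁ Y X (n * walk u c) (j * (n * walk u c)) (pos (u + j * u)) ⟩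
      (Y + n * walk u c + pos (u + j * u)) + (j * (n * walk u c) + X)
        ≡⟨ cong₂ _+_ (lift-u (j * u)) (lift-* j) ⟩
      (n * walk (u + j * u) c + (X + a)) + (Y + j * a)
        ≡⟨ r₂ (n * walk (u + j * u) c) X a Y (j * a) ⟩
      (Y + X) + (n * walk (u + j * u) c + (a + j * a)) ∎)
      where
      Y = n * walk (j * u) c
      X = pos (j * u)
      r₁ : ∀ Y X s t q → (Y + X) + ((s + t) + q) ≡ (Y + s + q) + (t + X)
      r₁ = ℕSolver.solve-∀
      r₂ : ∀ s X a Y t → (s + (X + a)) + (Y + t) ≡ (Y + X) + (s + (a + t))
      r₂ = ℕSolver.solve-∀

    -- Since `p u` is `v` full turns, the walk ends at 0 after `v (p e)` ascents, so
    -- `p L(u) = n v p e`. The factor `p` coming from the ascents cancels the `p` on the left.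
    nWu : n * walk u c ≡ v * e * n + a
    nWu = *-cancelˡ-≡ _ _ p (begin
      p * (n * walk u c)                     ≡⟨ sym (+-identityʳ _) ⟩
      p * (n * walk u c) + 0                 ≡⟨ cong (p * (n * walk u c) +_) (sym (trans (cong pos pu≡vn) (cong first (rotate^-* c v)))) ⟩
      p * (n * walk u c) + pos (p * u)       ≡⟨ lift-* p ⟩
      n * walk (p * u) c + p * a             ≡⟨ cong (λ t → n * walk t c + p * a) pu≡vn ⟩
      n * walk (v * n) c + p * a             ≡⟨ cong (λ t → n * t + p * a) (trans (walk-* v c) (cong (v *_) asc≡pe)) ⟩
      n * (v * (p * e)) + p * a              ≡⟨ r n v p e a ⟩
      p * (v * e * n + a)                    ∎)
      where
      r : ∀ n v p e a → n * (v * (p * e)) + p * a ≡ p * (v * e * n + a)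
      r = ℕSolver.solve-∀

-- Parity

odd : ℕ → Bool
odd zero    = false
odd (suc n) = not (odd n)

odd-+ : ∀ m n → odd (m + n) ≡ odd m xor odd n
odd-+ zero    n = refl
odd-+ (suc m) n rewrite odd-+ m n with odd m
... | true  = not-involutive (odd n)
... | false = refl

odd-* : ∀ m n → odd (m * n) ≡ odd m ∧ odd n
odd-* zero    n = refl
odd-* (suc m) n rewrite odd-+ n (m * n) | odd-* m n with odd m | odd n
... | true  | true  = refl
... | true  | false = refl
... | false | true  = refl
... | false | false = refl

%2≡ᵇ : ∀ a b → (a % 2 ≡ᵇ b % 2) ≡ not (odd a xor odd b)
%2≡ᵇ zero          zero          = refl
%2≡ᵇ zero          (suc zero)    = refl
%2≡ᵇ zero          (suc (suc b)) = trans (%2≡ᵇ zero b) (cong not (sym (not-involutive (odd b))))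
%2≡ᵇ (suc zero)    zero          = refl
%2≡ᵇ (suc zero)    (suc zero)    = refl
%2≡ᵇ (suc zero)    (suc (suc b)) = trans (%2≡ᵇ (suc zero) b) (cong (not ∘ not) (sym (not-involutive (odd b))))
%2≡ᵇ (suc (suc a)) b             = trans (%2≡ᵇ a b) (cong (λ o → not (o xor odd b)) (sym (not-involutive (odd a))))

isEvenPerm-odd : ∀ w → isEvenPerm w ≡ not (odd (inversions w))
isEvenPerm-odd w = trans (%2≡ᵇ (inversions w) 0) (cong not (xor-identityʳ (odd (inversions w))))

isPAP-∷ : ∀ a b w → isPAP (a ∷ b ∷ w) ≡ (odd a xor odd b) ∧ isPAP (b ∷ w)
isPAP-∷ a b w = cong (_∧ isPAP (b ∷ w)) (trans (cong not (%2≡ᵇ a b)) (not-involutive _))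

sumℤ : {A : Set} → (A → ℤ) → List A → ℤ
sumℤ f []       = 0ℤ
sumℤ f (x ∷ xs) = f x +ᶻ sumℤ f xs

sumℤ-↭ : {A : Set} (f : A → ℤ) {xs ys : List A} → xs ↭ ys → sumℤ f xs ≡ sumℤ f ys
sumℤ-↭ f _↭_.refl              = refl
sumℤ-↭ f (prep x p)        = cong (f x +ᶻ_) (sumℤ-↭ f p)
sumℤ-↭ f (_↭_.swap x y p)  = trans (cong (λ s → f x +ᶻ (f y +ᶻ s)) (sumℤ-↭ f p)) (exchange (f x) (f y) _)
  where
  exchange : ∀ a b c → a +ᶻ (b +ᶻ c) ≡ b +ᶻ (a +ᶻ c)
  exchange = ℤSolver.solve-∀
sumℤ-↭ f (_↭_.trans p q)   = trans (sumℤ-↭ f p) (sumℤ-↭ f q)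

upTo-suc : ∀ N → upTo (suc N) ≡ 0 ∷ map suc (upTo N)
upTo-suc N = cong (0 ∷_) (sym (map-upTo suc N))

∈-perm : ∀ {N w} → IsPerm N w → ∀ {y} → y < N → suc y ∈ w
∈-perm {suc N} w-perm {y} y< with a , v , a< , v-perm , refl ← perm-uncons w-perm with a ≟ y
... | yes refl = here refl
... | no  a≢y with x , x< , refl ← skip-surjective a a< y< a≢y = there (∈-map⁺ (skip (suc a)) (∈-perm v-perm x<))

perm-↭ : ∀ {N w} → IsPerm N w → w ↭ letters N
perm-↭ {N} w-perm@(isPerm _ all u) = unique⇒↭ u (letters-unique N) (All.lookup all)
  (λ x∈ → let (y , eq , y<) = ∈-letters⁻ x∈ in subst (_∈ _) (sym eq) (∈-perm w-perm y<))

perm-positive : ∀ {N w} → IsPerm N w → All (0 <_) w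
perm-positive {N} w-perm = All.map (λ x∈ → let (y , eq , _) = ∈-letters⁻ {N} x∈ in subst (0 <_) (sym eq) (s≤s z≤n)) (IsPerm.all∈ w-perm)

perm-bounded : ∀ {N w} → IsPerm N w → All (_< suc N) (0 ∷ w)
perm-bounded {N} w-perm = s≤s z≤n ∷
  All.map (λ x∈ → let (y , eq , y<) = ∈-letters⁻ {N} x∈ in subst (_< suc N) (sym eq) (s≤s y<)) (IsPerm.all∈ w-perm)

alternating : ℕ → ℤ
alternating zero    = 1ℤ
alternating (suc n) = - alternating n

alternating-odd : ∀ a → alternating a ≡ (if odd a then -1ℤ else 1ℤ)
alternating-odd zero    = refl
alternating-odd (suc a) rewrite alternating-odd a with odd a
... | true  = refl
... | false = refl

sum-alternating-suc : ∀ l → sumℤ alternating (map suc l) ≡ - sumℤ alternating l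
sum-alternating-suc []      = refl
sum-alternating-suc (x ∷ l) = trans (cong (- alternating x +ᶻ_) (sum-alternating-suc l))
  (sym (ℤ.neg-distrib-+ (alternating x) (sumℤ alternating l)))

sum-alternating-upTo : ∀ N → sumℤ alternating (upTo N) ≡ (if odd N then 1ℤ else 0ℤ)
sum-alternating-upTo zero    = refl
sum-alternating-upTo (suc N)
  rewrite sym (map-upTo suc N) | sum-alternating-suc (upTo N) | sum-alternating-upTo N with odd N
... | true  = refl
... | false = refl

-- Adjacent terms cancel, so one term is left exactly when the whole word has odd length. Comparison
-- with the same sum over all letters will determine its sign.
sum-alternating-PAP : ∀ x xs → isPAP (x ∷ xs) ≡ true →
                      sumℤ alternating (x ∷ xs) ≡ (if odd (length xs) then 0ℤ else alternating x)
sum-alternating-PAP x []       _   = ℤ.+-identityʳ _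
sum-alternating-PAP x (y ∷ ys) pap
  rewrite isPAP-∷ x y ys with odd x in ox | odd y in oy
... | true  | false rewrite sum-alternating-PAP y ys pap | alternating-odd x | alternating-odd y | ox | oy with odd (length ys)
...   | true  = refl
...   | false = refl
sum-alternating-PAP x (y ∷ ys) pap | false | true rewrite sum-alternating-PAP y ys pap | alternating-odd x | alternating-odd y | ox | oy with odd (length ys)
...   | true  = refl
...   | false = refl

-- [N] has one odd letter more than it has even ones when N is odd.
PAP-first-odd : ∀ {N a as} → IsPerm N (a ∷ as) → odd N ≡ true → isPAP (a ∷ as) ≡ true → odd a ≡ true
PAP-first-odd {suc N} {a} {as} w-perm oN pap with odd a in oa
... | true  = refl
... | false = contradiction one≡-one λ ()
  where
  even-tail : odd (length as) ≡ false
  even-tail = trans (cong odd (suc-injective (IsPerm.len w-perm))) (trans (sym (not-involutive (odd N))) (cong not oN))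
  one≡-one : 1ℤ ≡ -1ℤ
  one≡-one = begin
    1ℤ                                    ≡⟨ cong (λ b → if b then -1ℤ else 1ℤ) (sym oa) ⟩
    (if odd a then -1ℤ else 1ℤ)           ≡⟨ sym (alternating-odd a) ⟩
    alternating a                         ≡⟨ cong (λ b → if b then 0ℤ else alternating a) (sym even-tail) ⟩
    (if odd (length as) then 0ℤ else alternating a) ≡⟨ sym (sum-alternating-PAP a as pap) ⟩
    sumℤ alternating (a ∷ as)             ≡⟨ sumℤ-↭ alternating (perm-↭ w-perm) ⟩
    sumℤ alternating (letters (suc N))    ≡⟨ sum-alternating-suc (upTo (suc N)) ⟩
    - sumℤ alternating (upTo (suc N))     ≡⟨ cong -_ (trans (sum-alternating-upTo (suc N)) (cong (λ b → if b then 1ℤ else 0ℤ) oN)) ⟩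
    -1ℤ                                   ∎

-- In an alternating word, `odd x xor odd (length xs)` is the parity of the last entry; it must be
-- odd for the even letter 0 to follow.
isPAP-++0 : ∀ x xs → isPAP (x ∷ xs) ≡ true → odd x xor odd (length xs) ≡ true → isPAP (x ∷ xs ++ [ 0 ]) ≡ true
isPAP-++0 x []       _   o rewrite isPAP-∷ x 0 [] | o = refl
isPAP-++0 x (y ∷ ys) pap o rewrite isPAP-∷ x y ys | isPAP-∷ x y (ys ++ [ 0 ]) with odd x | odd y in oy
... | true  | false = isPAP-++0 y ys pap (trans (cong (_xor odd (length ys)) oy) (trans (sym (not-involutive _)) o))
... | false | true  = isPAP-++0 y ys pap (trans (cong (_xor odd (length ys)) oy) o)

-- Inversions counted by letters below a threshold

below : ℕ → List ℕ → ℕ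
below a = countᵇ (_<ᵇ a)

below-∷ : ∀ a x l → below a (x ∷ l) ≡ lt x a + below a l
below-∷ a x l with x <ᵇ a
... | true  = refl
... | false = refl

below-↭ : ∀ a {xs ys} → xs ↭ ys → below a xs ≡ below a ys
below-↭ a {xs} {ys} p = begin
  length (filterᵇ (_<ᵇ a) xs)              ≡⟨ cong length (filterᵇ≡filter (_<ᵇ a) xs) ⟩
  length (filter (T? ∘ (_<ᵇ a)) xs)        ≡⟨ ↭-length (filter-↭ (T? ∘ (_<ᵇ a)) p) ⟩
  length (filter (T? ∘ (_<ᵇ a)) ys)        ≡⟨ cong length (sym (filterᵇ≡filter (_<ᵇ a) ys)) ⟩
  length (filterᵇ (_<ᵇ a) ys)              ∎

below-0 : ∀ l → below 0 l ≡ 0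
below-0 []      = refl
below-0 (x ∷ l) = below-0 l

below-suc : ∀ a l → below (suc a) (map suc l) ≡ below a l
below-suc a []      = refl
below-suc a (x ∷ l) = trans (below-∷ (suc a) (suc x) (map suc l))
  (trans (cong (lt x a +_) (below-suc a l)) (sym (below-∷ a x l)))

below-upTo : ∀ a N → a ≤ N → below a (upTo N) ≡ a
below-upTo zero    N       _         = below-0 (upTo N)
below-upTo (suc a) (suc N) (s≤s a≤N) = trans (cong (below (suc a)) (upTo-suc N))
  (cong suc (trans (below-suc a (upTo N)) (below-upTo a N a≤N)))

below-perm : ∀ {N w a} → IsPerm N w → a ≤ N → below (suc a) w ≡ a
below-perm {N} {w} {a} w-perm a≤N = trans (below-↭ (suc a) (perm-↭ w-perm)) (trans (below-suc a (upTo N)) (below-upTo a N a≤N))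

inversions-++0 : ∀ {w} → All (0 <_) w → inversions (w ++ [ 0 ]) ≡ inversions w + length w
inversions-++0 []                            = refl
inversions-++0 {suc x ∷ w} (_ ∷ pos) = begin
  below (suc x) (w ++ [ 0 ]) + inversions (w ++ [ 0 ])
    ≡⟨ cong₂ _+_ (below-↭ (suc x) (↭-sym (∷↭∷ʳ 0 w))) (inversions-++0 pos) ⟩
  suc (below (suc x) w) + (inversions w + length w) ≡⟨ r (below (suc x) w) (inversions w) (length w) ⟩
  below (suc x) w + inversions w + suc (length w)   ∎
  where
  r : ∀ b i l → suc b + (i + l) ≡ b + i + suc l
  r = ℕSolver.solve-∀

-- Invariance of ascents, parity alternation and sign under `rho`

module Symmetry (n : ℕ) where
  open Circle n
  open Rotation n

  -- This is `lt-shift`, with the letters of `l` in the role of `b` and `x` in that of `c`, summed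
  -- over `l`.
  below-shift : ∀ {a x} → a < n → x < n → ∀ {l} → Bounded l →
                below (shift a x) (map (shift a) l) + below a l ≡ below x l + length l * lt x a
  below-shift             a< x< []              = refl
  below-shift {a} {x} a< x< {y ∷ l} (y< ∷ l<) = begin
    below (shift a x) (shift a y ∷ map (shift a) l) + below a (y ∷ l)
      ≡⟨ cong₂ _+_ (below-∷ (shift a x) (shift a y) (map (shift a) l)) (below-∷ a y l) ⟩
    (lt (shift a y) (shift a x) + b) + (lt y a + below a l)
      ≡⟨ r (lt (shift a y) (shift a x)) b (lt y a) (below a l) ⟩
    (lt (shift a y) (shift a x) + lt y a) + (b + below a l)
      ≡⟨ cong₂ _+_ (lt-shift a< y< x<) (below-shift a< x< l<) ⟩
    (lt y x + lt x a) + (below x l + length l * lt x a)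
      ≡⟨ r (lt y x) (lt x a) (below x l) (length l * lt x a) ⟩
    (lt y x + below x l) + (lt x a + length l * lt x a)
      ≡⟨ cong (_+ suc (length l) * lt x a) (sym (below-∷ x y l)) ⟩
    below x (y ∷ l) + suc (length l) * lt x a ∎
    where
    b = below (shift a x) (map (shift a) l)
    r : ∀ s t u v → (s + t) + (u + v) ≡ (s + u) + (t + v)
    r = ℕSolver.solve-∀

  -- A pair changes its order under `shift a` exactly when one entry is below `a` and the other is
  -- not. With `b` entries below `a` among `L` there are `b (L - b)` such pairs, which modulo 2 is
  -- `L b + b`.
  odd-inversions-shift : ∀ {a} → a < n → ∀ {l} → Bounded l →
    odd (inversions (map (shift a) l)) xor (odd (inversions l) xor odd (below a l)) ≡ odd (length l) ∧ odd (below a l)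
  odd-inversions-shift         a< []            = refl
  odd-inversions-shift {a} a< {x ∷ l} (x< ∷ l<)
    rewrite below-∷ a x l
          | odd-+ (below (shift a x) (map (shift a) l)) (inversions (map (shift a) l))
          | odd-+ (below x l) (inversions l)
          | odd-+ (lt x a) (below a l)
    = xor-cancel
        (odd (below (shift a x) (map (shift a) l))) (odd (inversions (map (shift a) l)))
        (odd (below x l)) (odd (inversions l)) (odd (lt x a)) (odd (below a l)) (odd (length l))
        parity-below (odd-inversions-shift a< l<)
    where
    parity-below : odd (below (shift a x) (map (shift a) l)) xor odd (below a l) ≡
                   odd (below x l) xor (odd (length l) ∧ odd (lt x a))
    parity-below = begin
      odd (below (shift a x) (map (shift a) l)) xor odd (below a l) ≡⟨ sym (odd-+ (below (shift a x) (map (shift a) l)) (below a l)) ⟩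
      odd (below (shift a x) (map (shift a) l) + below a l)         ≡⟨ cong odd (below-shift a< x< l<) ⟩
      odd (below x l + length l * lt x a)                           ≡⟨ odd-+ (below x l) (length l * lt x a) ⟩
      odd (below x l) xor odd (length l * lt x a)                   ≡⟨ cong (odd (below x l) xor_) (odd-* (length l) (lt x a)) ⟩
      odd (below x l) xor (odd (length l) ∧ odd (lt x a))           ∎
    -- The sum of the two hypotheses in the field with two elements; `not k` is `1 + k`, the parity
    -- of the length after adding the letter.
    xor-cancel : ∀ b′ i′ b i h c k → b′ xor c ≡ b xor (k ∧ h) → i′ xor (i xor c) ≡ k ∧ c →
                 (b′ xor i′) xor ((b xor i) xor (h xor c)) ≡ not k ∧ (h xor c)
    xor-cancel b′ i′ b i h c k e₁ e₂ = begin
      (b′ xor i′) xor ((b xor i) xor (h xor c))                    ≡⟨ solve 6 (λ b′ i′ b i h c →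
                                                                       (b′ :+ i′) :+ ((b :+ i) :+ (h :+ c)) :=
                                                                       ((b′ :+ c) :+ (i′ :+ (i :+ c))) :+ (b :+ (h :+ c))) refl b′ i′ b i h c ⟩
      ((b′ xor c) xor (i′ xor (i xor c))) xor (b xor (h xor c))    ≡⟨ cong₂ (λ s t → (s xor t) xor (b xor (h xor c))) e₁ e₂ ⟩
      ((b xor (k ∧ h)) xor (k ∧ c)) xor (b xor (h xor c))          ≡⟨ solve 4 (λ b h c k →
                                                                       ((b :+ (k :* h)) :+ (k :* c)) :+ (b :+ (h :+ c)) :=
                                                                       (con true :+ k) :* (h :+ c)) refl b h c k ⟩
      not k ∧ (h xor c)                                            ∎
      where open xor-∧-Solver

  rho-length : ∀ w → length (rho w) ≡ length w
  rho-length []       = refl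
  rho-length (a ∷ as) = trans (length-map (shift a) (as ++ [ 0 ])) (trans (length-++ as) (+-comm (length as) 1))

  rho-perm : ∀ {N w} → suc N ≡ n → IsPerm N w → IsPerm N (rho w)
  rho-perm {N} {w} refl w-perm@(isPerm len _ u) =
    isPerm (trans (rho-length w) len) (letters∈ (All.zipWith id (0∉ , <n))) uρ
    where
    c<  = perm-bounded w-perm
    l   = rotate (0 ∷ w)
    l<  = rotate^-bounded 1 c<
    a<  = first-bounded (rotate^-nonempty 1 {0 ∷ w} (s≤s z≤n)) l<
    c-unique : Unique (0 ∷ w)
    c-unique = All.map (λ 0<x 0≡x → <⇒≢ 0<x 0≡x) (perm-positive w-perm) ∷ u
    ρ-unique : Unique (0 ∷ rho w)
    ρ-unique = subst Unique (sym (rho-normalise w))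
      (Unique-map-local (shift-injective a<) l< (Unique-resp-↭ (rotate-↭ (0 ∷ w)) c-unique))
    0∉ : All (0 ≢_) (rho w)
    0∉ with ∉ ∷ _ ← ρ-unique = ∉
    uρ : Unique (rho w)
    uρ with _ ∷ u ← ρ-unique = u
    <n : All (_< suc N) (rho w)
    <n with _ ∷ <n ← subst Bounded (sym (rho-normalise w)) (All.map⁺ (All.map (shift-bound a<) l<)) = <n
    letters∈ : ∀ {v} → All (λ x → 0 ≢ x × x < suc N) v → All (_∈ letters N) v
    letters∈ = All.map λ { {zero} (0≢ , _) → contradiction refl 0≢ ; {suc x} (_ , s≤s x<) → ∈-letters⁺ x< }

  rho-ascents : ∀ {N w} → suc N ≡ n → 0 < N → IsPerm N w → ascents (rho w) ≡ ascents w
  rho-ascents {_} {w} refl N>0 w-perm@(isPerm refl _ _) = suc-injective (begin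
    suc (ascents (rho w))                        ≡⟨ sym (walk-around (subst (0 <_) (sym (rho-length w)) N>0) (perm-positive (rho-perm refl w-perm))) ⟩
    walk (suc (length (rho w))) (0 ∷ rho w)      ≡⟨ cong (λ k → walk (suc k) (0 ∷ rho w)) (rho-length w) ⟩
    walk (suc (length w)) (0 ∷ rho w)            ≡⟨ walk-rho w (perm-bounded w-perm) ⟩
    walk (suc (length w)) (0 ∷ w)                ≡⟨ walk-around N>0 (perm-positive w-perm) ⟩
    suc (ascents w)                              ∎)

  -- Reduction modulo an even `n` does not disturb parities.
  odd-shift : odd n ≡ false → ∀ {a} → a < n → ∀ b → odd (shift a b) ≡ odd b xor odd a
  odd-shift even-n {a} a< b = begin
    odd (shift a b)                           ≡⟨ sym (xor-identityʳ _) ⟩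
    odd (shift a b) xor false                 ≡⟨ cong (odd (shift a b) xor_) (sym (xor-same (odd a))) ⟩
    odd (shift a b) xor (odd a xor odd a)     ≡⟨ sym (xor-assoc (odd (shift a b)) (odd a) (odd a)) ⟩
    (odd (shift a b) xor odd a) xor odd a     ≡⟨ cong (_xor odd a) (sym (odd-+ (shift a b) a)) ⟩
    odd (shift a b + a) xor odd a             ≡⟨ cong (λ k → odd k xor odd a) (shift-+ b a<) ⟩
    odd (b + n * lt b a) xor odd a            ≡⟨ cong (_xor odd a) (trans (odd-+ b (n * lt b a)) (cong (odd b xor_) (trans (odd-* n (lt b a)) (cong (_∧ odd (lt b a)) even-n)))) ⟩
    (odd b xor false) xor odd a               ≡⟨ cong (_xor odd a) (xor-identityʳ (odd b)) ⟩
    odd b xor odd a                           ∎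

  isPAP-shift : odd n ≡ false → ∀ {a} → a < n → ∀ l → isPAP (map (shift a) l) ≡ isPAP l
  isPAP-shift even-n a< []          = refl
  isPAP-shift even-n a< (x ∷ [])    = refl
  isPAP-shift even-n {a} a< (x ∷ y ∷ l) = begin
    isPAP (map (shift a) (x ∷ y ∷ l))
      ≡⟨ isPAP-∷ (shift a x) (shift a y) (map (shift a) l) ⟩
    (odd (shift a x) xor odd (shift a y)) ∧ isPAP (map (shift a) (y ∷ l))
      ≡⟨ cong₂ _∧_ (trans (cong₂ _xor_ (odd-shift even-n a< x) (odd-shift even-n a< y)) (cancel (odd x) (odd y) (odd a))) (isPAP-shift even-n a< (y ∷ l)) ⟩
    (odd x xor odd y) ∧ isPAP (y ∷ l)
      ≡⟨ sym (isPAP-∷ x y l) ⟩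
    isPAP (x ∷ y ∷ l) ∎
    where
    open xor-∧-Solver
    cancel : ∀ s t u → (s xor u) xor (t xor u) ≡ s xor t
    cancel = solve 3 (λ s t u → (s :+ u) :+ (t :+ u) := s :+ t) refl

  -- A PAP of odd length starts with an odd letter, hence also ends with one, so 0 can be appended.
  -- Shifting by a constant then flips either all parities or none.
  rho-PAP : odd n ≡ false → ∀ {N w} → suc N ≡ n → IsPerm N w → isPAP w ≡ true → isPAP (rho w) ≡ true
  rho-PAP even-n {w = []}     _  _      pap = pap
  rho-PAP even-n {w = a ∷ as} refl w-perm@(isPerm len _ _) pap with perm-bounded w-perm
  ... | _ ∷ a< ∷ _ = begin
    isPAP (map (shift a) (as ++ [ 0 ]))       ≡⟨ isPAP-shift even-n a< (as ++ [ 0 ]) ⟩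
    isPAP (as ++ [ 0 ])                       ≡⟨ tail-PAP as (isPAP-++0 a as pap odd-a+as) ⟩
    true                                      ∎
    where
    odd-N = trans (sym (not-involutive _)) (cong not even-n)
    odd-a = PAP-first-odd w-perm odd-N pap
    odd-a+as : odd a xor odd (length as) ≡ true
    odd-a+as = trans (cong (_xor odd (length as)) odd-a) (trans (cong odd len) odd-N)
    tail-PAP : ∀ xs → isPAP (a ∷ xs ++ [ 0 ]) ≡ true → isPAP (xs ++ [ 0 ]) ≡ true
    tail-PAP []       _ = refl
    tail-PAP (x ∷ xs) t rewrite isPAP-∷ a x (xs ++ [ 0 ]) with odd a xor odd x
    ... | true = t

  -- Two odd contributions cancel: the final 0 adds `N` inversions, and the shift contributes
  -- `below a l`, which equals the odd first letter `a`. The product term in `odd-inversions-shift`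
  -- vanishes because the length `n` is even.
  rho-inversions : odd n ≡ false → ∀ {N w} → suc N ≡ n → IsPerm N w → isPAP w ≡ true →
                   odd (inversions (rho w)) ≡ odd (inversions w)
  rho-inversions even-n {w = []}     _    _      _   = refl
  rho-inversions even-n {N} {a ∷ as} refl w-perm@(isPerm len _ _) pap
    with a∈ ∷ _ ← IsPerm.all∈ w-perm
    with a′ , refl , a′< ← ∈-letters⁻ {N} a∈
    = conclude (odd (inversions (rho w))) (odd (inversions w)) (begin
      odd (inversions (rho w)) xor ((odd (inversions w) xor true) xor true)
        ≡⟨ cong₂ (λ s t → odd s xor ((odd (inversions w) xor t) xor true)) (sym inv-map) (sym (trans (cong odd len) odd-N)) ⟩
      odd (inversions (map (shift a) l)) xor ((odd (inversions w) xor odd (length w)) xor true)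
        ≡⟨ cong₂ (λ s t → odd (inversions (map (shift a) l)) xor (s xor t))
             (sym (trans (cong odd (inversions-++0 (perm-positive w-perm))) (odd-+ (inversions w) (length w))))
             (sym (trans (cong odd below-l) odd-a)) ⟩
      odd (inversions (map (shift a) l)) xor (odd (inversions l) xor odd (below a l))
        ≡⟨ odd-inversions-shift (s≤s a′<) (rotate^-bounded 1 (perm-bounded w-perm)) ⟩
      odd (length l) ∧ odd (below a l)
        ≡⟨ cong (λ k → odd k ∧ odd (below a l)) (trans (sym (↭-length (rotate-↭ (0 ∷ w)))) (cong suc len)) ⟩
      odd n ∧ odd (below a l)
        ≡⟨ cong (_∧ odd (below a l)) even-n ⟩
      false ∎)
    where
    w = a ∷ as
    l = rotate (0 ∷ w)
    odd-N = trans (sym (not-involutive (odd N))) (cong not even-n)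
    odd-a = PAP-first-odd w-perm odd-N pap
    inv-map : inversions (map (shift a) l) ≡ inversions (rho w)
    inv-map = trans (cong inversions (sym (rho-normalise w))) (cong (_+ inversions (rho w)) (below-0 (rho w)))
    below-l : below a l ≡ a
    below-l = trans (below-↭ a (↭-sym (rotate-↭ (0 ∷ w)))) (trans (below-∷ a 0 w) (cong suc (below-perm w-perm (<⇒≤ a′<))))
    conclude : ∀ s t → s xor ((t xor true) xor true) ≡ false → s ≡ t
    conclude true  true  _ = refl
    conclude false false _ = refl

open import Data.Integer using (-[1+_]) renaming (_*_ to _*ᶻ_; +_ to pos)

-- Formal power series

Series : Set
Series = ℕ → ℤ

-- Multiplication by t and by 1 - t of the formal power series Σ f(x) t^x.
delay : Series → Series
delay f zero    = 0ℤ
delay f (suc x) = f x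

Δ : Series → Series
Δ f x = f x - delay f x

Δ^ : ℕ → Series → Series
Δ^ zero    f = f
Δ^ (suc n) f = Δ (Δ^ n f)

delay-cong : ∀ {f g} → f ≗ g → delay f ≗ delay g
delay-cong eq zero    = refl
delay-cong eq (suc x) = eq x

Δ-cong : ∀ {f g} → f ≗ g → Δ f ≗ Δ g
Δ-cong eq x = cong₂ _-_ (eq x) (delay-cong eq x)

Δ^-cong : ∀ n {f g} → f ≗ g → Δ^ n f ≗ Δ^ n g
Δ^-cong zero    eq = eq
Δ^-cong (suc n) eq = Δ-cong (Δ^-cong n eq)

delay-Δ : ∀ f → delay (Δ f) ≗ Δ (delay f)
delay-Δ f zero    = refl
delay-Δ f (suc x) = refl

delay-Δ^ : ∀ n f → delay (Δ^ n f) ≗ Δ^ n (delay f)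
delay-Δ^ zero    f x = refl
delay-Δ^ (suc n) f x = trans (delay-Δ (Δ^ n f) x) (Δ-cong (delay-Δ^ n f) x)

delay-minus : ∀ f g → delay (λ y → f y - g y) ≗ (λ x → delay f x - delay g x)
delay-minus f g zero    = refl
delay-minus f g (suc x) = refl

delay-scale : ∀ c f → delay (λ y → c *ᶻ f y) ≗ (λ x → c *ᶻ delay f x)
delay-scale c f zero    = sym (ℤ.*-zeroʳ c)
delay-scale c f (suc x) = refl

Δ-minus : ∀ f g → Δ (λ y → f y - g y) ≗ (λ x → Δ f x - Δ g x)
Δ-minus f g x = trans (cong (λ z → f x - g x - z) (delay-minus f g x)) (r (f x) (g x) (delay f x) (delay g x))
  where
  r : ∀ a b c d → a - b - (c - d) ≡ a - c - (b - d)
  r = ℤSolver.solve-∀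

Δ-scale : ∀ c f → Δ (λ y → c *ᶻ f y) ≗ (λ x → c *ᶻ Δ f x)
Δ-scale c f x = trans (cong (λ z → c *ᶻ f x - z) (delay-scale c f x)) (r c (f x) (delay f x))
  where
  r : ∀ c a b → c *ᶻ a - c *ᶻ b ≡ c *ᶻ (a - b)
  r = ℤSolver.solve-∀

Δ^-minus : ∀ n f g → Δ^ n (λ y → f y - g y) ≗ (λ x → Δ^ n f x - Δ^ n g x)
Δ^-minus zero    f g x = refl
Δ^-minus (suc n) f g x = trans (Δ-cong (Δ^-minus n f g) x) (Δ-minus (Δ^ n f) (Δ^ n g) x)

-- The derivation rule: x ↦ x f(x) is t d/dt on series, and d/dt (1-t)^n = -n (1-t)^(n-1).
Δ^-times-x : ∀ n f → Δ^ (suc n) (λ y → pos y *ᶻ f y) ≗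
                     (λ x → pos x *ᶻ Δ^ (suc n) f x +ᶻ pos (suc n) *ᶻ delay (Δ^ n f) x)
Δ^-times-x zero f zero    = r (f 0)
  where
  r : ∀ a → 0ℤ *ᶻ a - 0ℤ ≡ 0ℤ *ᶻ (a - 0ℤ) +ᶻ 1ℤ *ᶻ 0ℤ
  r = ℤSolver.solve-∀
Δ^-times-x zero f (suc x) = trans (cong (λ z → z *ᶻ f (suc x) - pos x *ᶻ f x) (ℤ.pos-+ 1 x))
  (trans (r (pos x) (f (suc x)) (f x)) (cong (λ z → z *ᶻ (f (suc x) - f x) +ᶻ 1ℤ *ᶻ f x) (sym (ℤ.pos-+ 1 x))))
  where
  r : ∀ x a b → (1ℤ +ᶻ x) *ᶻ a - x *ᶻ b ≡ (1ℤ +ᶻ x) *ᶻ (a - b) +ᶻ 1ℤ *ᶻ b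
  r = ℤSolver.solve-∀
Δ^-times-x (suc n) f zero = trans (Δ-cong (Δ^-times-x n f) 0) (r (h 0) (pos (suc n)) (pos (suc (suc n))))
  where
  h = Δ^ (suc n) f
  r : ∀ a c d → 0ℤ *ᶻ a +ᶻ c *ᶻ 0ℤ - 0ℤ ≡ 0ℤ *ᶻ (a - 0ℤ) +ᶻ d *ᶻ 0ℤ
  r = ℤSolver.solve-∀
Δ^-times-x (suc n) f (suc x) = begin
  Δ (Δ^ (suc n) (λ y → pos y *ᶻ f y)) (suc x)
    ≡⟨ Δ-cong (Δ^-times-x n f) (suc x) ⟩
  (pos (suc x) *ᶻ h (suc x) +ᶻ c *ᶻ h′ x) - (pos x *ᶻ h x +ᶻ c *ᶻ delay h′ x)
    ≡⟨ cong (λ z → (z *ᶻ h (suc x) +ᶻ c *ᶻ h′ x) - (pos x *ᶻ h x +ᶻ c *ᶻ delay h′ x)) (ℤ.pos-+ 1 x) ⟩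
  ((1ℤ +ᶻ pos x) *ᶻ h (suc x) +ᶻ c *ᶻ h′ x) - (pos x *ᶻ h x +ᶻ c *ᶻ delay h′ x)
    ≡⟨ r (pos x) c (h (suc x)) (h′ x) (delay h′ x) ⟩
  (1ℤ +ᶻ pos x) *ᶻ (h (suc x) - h x) +ᶻ (1ℤ +ᶻ c) *ᶻ h x
    ≡⟨ cong₂ (λ y d → y *ᶻ (h (suc x) - h x) +ᶻ d *ᶻ h x) (sym (ℤ.pos-+ 1 x)) (sym (ℤ.pos-+ 1 (suc n))) ⟩
  pos (suc x) *ᶻ (h (suc x) - h x) +ᶻ pos (suc (suc n)) *ᶻ h x ∎
  where
  h  = Δ^ (suc n) f
  h′ = Δ^ n f
  c  = pos (suc n)
  r : ∀ x c a b d → ((1ℤ +ᶻ x) *ᶻ a +ᶻ c *ᶻ b) - (x *ᶻ (b - d) +ᶻ c *ᶻ d) ≡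
                    (1ℤ +ᶻ x) *ᶻ (a - (b - d)) +ᶻ (1ℤ +ᶻ c) *ᶻ (b - d)
  r = ℤSolver.solve-∀

-- Coefficients of `(1-t)^n Σ x^r t^x` modulo divisors of `n`

power : ℕ → Series
power r x = pos (x ^ r)

-- The derivation rule pulls out the `m` factors `x` one at a time; each time the correction term
-- carries the coefficient `suc n`, a multiple of `q`.
∣-Δ^-power : ∀ {q n} m r x → q ∣ℕ suc n → pos q ∣ᶻ (Δ^ (suc n) (power (m + r)) x - pos (x ^ m) *ᶻ Δ^ (suc n) (power r) x)
∣-Δ^-power {q} {n} zero r x q∣n = subst (pos q ∣ᶻ_) (sym (z (Δ^ (suc n) (power r) x))) (Signed.∣ᵤ⇒∣ (q ∣0))
  where
  z : ∀ a → a - 1ℤ *ᶻ a ≡ 0ℤ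
  z = ℤSolver.solve-∀
∣-Δ^-power {q} {n} (suc m) r x q∣n = subst (pos q ∣ᶻ_) (sym expand)
  (Signed.∣m∣n⇒∣m+n (Signed.∣n⇒∣m*n (pos x) (∣-Δ^-power m r x q∣n)) (Signed.∣m⇒∣m*n {m = pos (suc n)} (delay (Δ^ n (power (m + r))) x) (Signed.∣ᵤ⇒∣ q∣n)))
  where
  h = Δ^ (suc n) (power (m + r)) x
  d = delay (Δ^ n (power (m + r))) x
  k = Δ^ (suc n) (power r) x
  expand : Δ^ (suc n) (power (suc m + r)) x - pos (x ^ suc m) *ᶻ k ≡
           pos x *ᶻ (h - pos (x ^ m) *ᶻ k) +ᶻ pos (suc n) *ᶻ d
  expand = begin
    Δ^ (suc n) (power (suc m + r)) x - pos (x ^ suc m) *ᶻ k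
      ≡⟨ cong₂ (λ a b → a - b *ᶻ k) (trans (Δ^-cong (suc n) (λ y → ℤ.pos-* y (y ^ (m + r))) x) (Δ^-times-x n (power (m + r)) x)) (ℤ.pos-* x (x ^ m)) ⟩
    pos x *ᶻ h +ᶻ pos (suc n) *ᶻ d - pos x *ᶻ pos (x ^ m) *ᶻ k
      ≡⟨ s (pos x) h (pos (suc n)) d (pos (x ^ m)) k ⟩
    pos x *ᶻ (h - pos (x ^ m) *ᶻ k) +ᶻ pos (suc n) *ᶻ d ∎
    where
    s : ∀ x h c d y k → x *ᶻ h +ᶻ c *ᶻ d - x *ᶻ y *ᶻ k ≡ x *ᶻ (h - y *ᶻ k) +ᶻ c *ᶻ d
    s = ℤSolver.solve-∀

^-monoˡ-∣ : ∀ m {a b} → a ∣ℕ b → a ^ m ∣ℕ b ^ m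
^-monoˡ-∣ zero    _   = ∣-refl
^-monoˡ-∣ (suc m) a∣b = *-pres-∣ a∣b (^-monoˡ-∣ m a∣b)

-- By `m ≤ r` the power contains `m` factors to pull out, and `p ∣ x` makes their product a multiple
-- of `p ^ m`.
p^m∣Δ^-power : ∀ {p m n r x} → m ≤ r → p ^ m ∣ℕ suc n → p ∣ℕ x → pos (p ^ m) ∣ᶻ Δ^ (suc n) (power r) x
p^m∣Δ^-power {p} {m} {n} {r} {x} m≤r p^m∣n p∣x = subst (λ r → pos (p ^ m) ∣ᶻ Δ^ (suc n) (power r) x) (m+[n∸m]≡n m≤r)
  (subst (pos (p ^ m) ∣ᶻ_) (z (Δ^ (suc n) (power (m + (r ∸ m))) x) (pos (x ^ m) *ᶻ Δ^ (suc n) (power (r ∸ m)) x))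
    (Signed.∣m∣n⇒∣m+n (∣-Δ^-power m (r ∸ m) x p^m∣n)
      (Signed.∣m⇒∣m*n {m = pos (x ^ m)} (Δ^ (suc n) (power (r ∸ m)) x) (Signed.∣ᵤ⇒∣ (^-monoˡ-∣ m p∣x)))))
  where
  z : ∀ a b → a - b +ᶻ b ≡ a
  z = ℤSolver.solve-∀

-- The recursion for the signed Eulerian polynomials and its solution

double : ℕ → ℕ
double zero    = zero
double (suc n) = suc (suc (double n))

prefix : (ℕ → Series) → ℕ → Series
prefix f zero    x = 0ℤ
prefix f (suc a) x = prefix f a x +ᶻ f a x

monomial : ℕ → Series
monomial zero    zero    = 1ℤ
monomial zero    (suc x) = 0ℤ
monomial (suc a) zero    = 0ℤ
monomial (suc a) (suc x) = monomial a x

-- The signed generating function by ascents of the permutations of [N+1] with first letter α+1.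
-- Deleting the first letter gives ±(Σ_{β<α} + t Σ_{α≤β≤N}), here written with prefix sums.
signed : ℕ → ℕ → Series
signed zero    α   = monomial 0
signed (suc N) α x = alternating α *ᶻ (Δ (prefix (signed N) α) x +ᶻ delay (prefix (signed N) (suc N)) x)

bipower : ℕ → ℕ → Series
bipower i r x = pos (suc x ^ i * x ^ r)

bipower-minus : ∀ i r → (λ x → bipower (suc i) r x - bipower i (suc r) x) ≗ bipower i r
bipower-minus i r x = begin
  pos (suc x ^ suc i * x ^ r) - pos (suc x ^ i * x ^ suc r)
    ≡⟨ cong (λ a → pos a - pos (suc x ^ i * x ^ suc r)) (s x (suc x ^ i) (x ^ r)) ⟩
  pos (suc x ^ i * x ^ r + suc x ^ i * (x * x ^ r)) - pos (suc x ^ i * x ^ suc r)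
    ≡⟨ cong (_- pos (suc x ^ i * x ^ suc r)) (ℤ.pos-+ (suc x ^ i * x ^ r) (suc x ^ i * (x * x ^ r))) ⟩
  pos (suc x ^ i * x ^ r) +ᶻ pos (suc x ^ i * x ^ suc r) - pos (suc x ^ i * x ^ suc r)
    ≡⟨ z (pos (suc x ^ i * x ^ r)) (pos (suc x ^ i * x ^ suc r)) ⟩
  pos (suc x ^ i * x ^ r) ∎
  where
  s : ∀ x a b → suc x * a * b ≡ a * b + a * (x * b)
  s = ℕSolver.solve-∀
  z : ∀ a b → a +ᶻ b - b ≡ a
  z = ℤSolver.solve-∀

-- Multiplication by `t` reindexes `x + 1` to `x`. The exponent must be positive for the coefficient
-- at 0 to vanish on the right as well.
delay-bipower : ∀ d → delay (bipower (suc d) 0) ≗ bipower 0 (suc d)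
delay-bipower d zero    = refl
delay-bipower d (suc x) = cong pos (*-comm (suc x ^ suc d) 1)

alternating-double : ∀ i → alternating (double i) ≡ 1ℤ
alternating-double zero    = refl
alternating-double (suc i) = trans (ℤ.neg-involutive _) (alternating-double i)

-- One step from an even level to an odd one, then one from an odd level to an even one, for
-- arbitrary potentials `u`. At the even level the nonzero entries are differences of `u`, so the
-- prefix sums telescope up to the constant `u 0`. The end condition `t u_(s+1) = u_0` makes `t`
-- times the total equal to `(1-t) u_0`, which removes that constant.
module _ (s : ℕ) (u : ℕ → Series) (delay-u : delay (u (suc s)) ≗ u 0) where

  module _ (even : ∀ i → i ≤ s → signed (double s) (double i) ≗ (λ x → u (suc i) x - u i x))
           (oddᵉ : ∀ i → i < s → signed (double s) (suc (double i)) ≗ (λ _ → 0ℤ)) where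

    prefix-even : ∀ i → i ≤ s → prefix (signed (double s)) (double i) ≗ (λ x → u i x - u 0 x)
    prefix-odd  : ∀ i → i ≤ s → prefix (signed (double s)) (suc (double i)) ≗ (λ x → u (suc i) x - u 0 x)
    prefix-even zero    _   x = sym (ℤ.+-inverseʳ (u 0 x))
    prefix-even (suc i) i<s x = trans (cong₂ _+ᶻ_ (prefix-odd i (<⇒≤ i<s) x) (oddᵉ i i<s x)) (ℤ.+-identityʳ _)
    prefix-odd i i≤s x = trans (cong₂ _+ᶻ_ (prefix-even i i≤s x) (even i i≤s x)) (r (u i x) (u 0 x) (u (suc i) x))
      where
      r : ∀ a b c → a - b +ᶻ (c - a) ≡ c - b
      r = ℤSolver.solve-∀

    delay-total : delay (prefix (signed (double s)) (suc (double s))) ≗ Δ (u 0)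
    delay-total x = begin
      delay (prefix (signed (double s)) (suc (double s))) x   ≡⟨ delay-cong (prefix-odd s ≤-refl) x ⟩
      delay (λ y → u (suc s) y - u 0 y) x                     ≡⟨ delay-minus (u (suc s)) (u 0) x ⟩
      delay (u (suc s)) x - delay (u 0) x                     ≡⟨ cong (_- delay (u 0) x) (delay-u x) ⟩
      u 0 x - delay (u 0) x                                   ∎

    next-even : ∀ i → i ≤ s → signed (suc (double s)) (double i) ≗ Δ (u i)
    next-even i i≤s x = begin
      alternating (double i) *ᶻ (Δ (prefix (signed (double s)) (double i)) x +ᶻ delay (prefix (signed (double s)) (suc (double s))) x)
        ≡⟨ cong₂ _*ᶻ_ (alternating-double i) (cong₂ _+ᶻ_ (trans (Δ-cong (prefix-even i i≤s) x) (Δ-minus (u i) (u 0) x)) (delay-total x)) ⟩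
      1ℤ *ᶻ (Δ (u i) x - Δ (u 0) x +ᶻ Δ (u 0) x) ≡⟨ r (Δ (u i) x) (Δ (u 0) x) ⟩
      Δ (u i) x ∎
      where
      r : ∀ a b → 1ℤ *ᶻ (a - b +ᶻ b) ≡ a
      r = ℤSolver.solve-∀

    next-odd : ∀ i → i ≤ s → signed (suc (double s)) (suc (double i)) ≗ (λ x → - Δ (u (suc i)) x)
    next-odd i i≤s x = begin
      - alternating (double i) *ᶻ (Δ (prefix (signed (double s)) (suc (double i))) x +ᶻ delay (prefix (signed (double s)) (suc (double s))) x)
        ≡⟨ cong₂ (λ a b → - a *ᶻ b) (alternating-double i) (cong₂ _+ᶻ_ (trans (Δ-cong (prefix-odd i i≤s) x) (Δ-minus (u (suc i)) (u 0) x)) (delay-total x)) ⟩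
      -1ℤ *ᶻ (Δ (u (suc i)) x - Δ (u 0) x +ᶻ Δ (u 0) x) ≡⟨ r (Δ (u (suc i)) x) (Δ (u 0) x) ⟩
      - Δ (u (suc i)) x ∎
      where
      r : ∀ a b → -1ℤ *ᶻ (a - b +ᶻ b) ≡ - a
      r = ℤSolver.solve-∀

  -- At the odd level the entries are `u_0, -u_1, u_1, -u_2, ...`, so an odd number of them sums to
  -- `u_0`. The end condition now gives `- (1-t) u_0` for `t` times the total; this annihilates the
  -- entries of odd index at the next level.
  module _ (even : ∀ i → i ≤ s → signed (suc (double s)) (double i) ≗ u i)
           (oddᵉ : ∀ i → i ≤ s → signed (suc (double s)) (suc (double i)) ≗ (λ x → - u (suc i) x)) where

    prefix-even′ : ∀ i → i ≤ suc s → prefix (signed (suc (double s))) (double i) ≗ (λ x → u 0 x - u i x)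
    prefix-odd′  : ∀ i → i ≤ s → prefix (signed (suc (double s))) (suc (double i)) ≗ u 0
    prefix-even′ zero    _         x = sym (ℤ.+-inverseʳ (u 0 x))
    prefix-even′ (suc i) (s≤s i≤s) x = cong₂ _+ᶻ_ (prefix-odd′ i i≤s x) (oddᵉ i i≤s x)
    prefix-odd′ i i≤s x = trans (cong₂ _+ᶻ_ (prefix-even′ i (m≤n⇒m≤1+n i≤s) x) (even i i≤s x)) (r (u 0 x) (u i x))
      where
      r : ∀ a b → a - b +ᶻ b ≡ a
      r = ℤSolver.solve-∀

    delay-total′ : delay (prefix (signed (suc (double s))) (double (suc s))) ≗ (λ x → - Δ (u 0) x)
    delay-total′ x = begin
      delay (prefix (signed (suc (double s))) (double (suc s))) x ≡⟨ delay-cong (prefix-even′ (suc s) ≤-refl) x ⟩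
      delay (λ y → u 0 y - u (suc s) y) x                         ≡⟨ delay-minus (u 0) (u (suc s)) x ⟩
      delay (u 0) x - delay (u (suc s)) x                         ≡⟨ cong (λ z → delay (u 0) x - z) (delay-u x) ⟩
      delay (u 0) x - u 0 x                                       ≡⟨ r (delay (u 0) x) (u 0 x) ⟩
      - (u 0 x - delay (u 0) x)                                   ∎
      where
      r : ∀ a b → a - b ≡ - (b - a)
      r = ℤSolver.solve-∀

    next-even′ : ∀ i → i ≤ suc s → signed (double (suc s)) (double i) ≗ (λ x → - Δ (u i) x)
    next-even′ i i≤s x = begin
      alternating (double i) *ᶻ (Δ (prefix (signed (suc (double s))) (double i)) x +ᶻ delay (prefix (signed (suc (double s))) (double (suc s))) x)
        ≡⟨ cong₂ _*ᶻ_ (alternating-double i) (cong₂ _+ᶻ_ (trans (Δ-cong (prefix-even′ i i≤s) x) (Δ-minus (u 0) (u i) x)) (delay-total′ x)) ⟩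
      1ℤ *ᶻ (Δ (u 0) x - Δ (u i) x - Δ (u 0) x) ≡⟨ r (Δ (u i) x) (Δ (u 0) x) ⟩
      - Δ (u i) x ∎
      where
      r : ∀ a b → 1ℤ *ᶻ (b - a - b) ≡ - a
      r = ℤSolver.solve-∀

    next-odd′ : ∀ i → i ≤ s → signed (double (suc s)) (suc (double i)) ≗ (λ _ → 0ℤ)
    next-odd′ i i≤s x = begin
      - alternating (double i) *ᶻ (Δ (prefix (signed (suc (double s))) (suc (double i))) x +ᶻ delay (prefix (signed (suc (double s))) (double (suc s))) x)
        ≡⟨ cong (- alternating (double i) *ᶻ_) (trans (cong₂ _+ᶻ_ (Δ-cong (prefix-odd′ i i≤s) x) (delay-total′ x)) (ℤ.+-inverseʳ (Δ (u 0) x))) ⟩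
      - alternating (double i) *ᶻ 0ℤ ≡⟨ ℤ.*-zeroʳ (- alternating (double i)) ⟩
      0ℤ ∎

scaled : ℕ → Series → Series
scaled s f x = alternating s *ᶻ Δ^ (suc (double s)) f x

scaled-cong : ∀ s {f g} → f ≗ g → scaled s f ≗ scaled s g
scaled-cong s eq x = cong (alternating s *ᶻ_) (Δ^-cong (suc (double s)) eq x)

scaled-minus : ∀ s f g → scaled s (λ y → f y - g y) ≗ (λ x → scaled s f x - scaled s g x)
scaled-minus s f g x = trans (cong (alternating s *ᶻ_) (Δ^-minus (suc (double s)) f g x))
  (r (alternating s) (Δ^ (suc (double s)) f x) (Δ^ (suc (double s)) g x))
  where
  r : ∀ c a b → c *ᶻ (a - b) ≡ c *ᶻ a - c *ᶻ b
  r = ℤSolver.solve-∀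

scaled-delay : ∀ s f → delay (scaled s f) ≗ scaled s (delay f)
scaled-delay s f x = trans (delay-scale (alternating s) (Δ^ (suc (double s)) f) x)
  (cong (alternating s *ᶻ_) (delay-Δ^ (suc (double s)) f x))

scaled-suc : ∀ s f → (λ x → - Δ (Δ (scaled s f)) x) ≗ scaled (suc s) f
scaled-suc s f x = begin
  - Δ (Δ (scaled s f)) x                              ≡⟨ cong -_ (Δ-cong (Δ-scale (alternating s) (Δ^ (suc (double s)) f)) x) ⟩
  - Δ (λ y → alternating s *ᶻ Δ^ (double (suc s)) f y) x   ≡⟨ cong -_ (Δ-scale (alternating s) (Δ^ (double (suc s)) f) x) ⟩
  - (alternating s *ᶻ Δ^ (suc (double (suc s))) f x)  ≡⟨ ℤ.neg-distribˡ-* (alternating s) _ ⟩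
  scaled (suc s) f x                                  ∎

-- The solution is signed (2s) (2i) = (-1)^s (1-t)^(2s+1) Σ_x (x+1)^i x^(s-i) t^x and
-- signed (2s) (2i+1) = 0; by bipower-minus its prefix sums telescope to differences of potentials.
potential : ℕ → ℕ → Series
potential s i = scaled s (bipower i (suc s ∸ i))

delay-potential : ∀ s → delay (potential s (suc s)) ≗ potential s 0
delay-potential s x = begin
  delay (scaled s (bipower (suc s) (s ∸ s))) x  ≡⟨ cong (λ r → delay (scaled s (bipower (suc s) r)) x) (n∸n≡0 s) ⟩
  delay (scaled s (bipower (suc s) 0)) x        ≡⟨ scaled-delay s (bipower (suc s) 0) x ⟩
  scaled s (delay (bipower (suc s) 0)) x        ≡⟨ scaled-cong s (delay-bipower s) x ⟩
  potential s 0 x                               ∎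

potential-minus : ∀ s i → i ≤ s → (λ x → potential s (suc i) x - potential s i x) ≗ scaled s (bipower i (s ∸ i))
potential-minus s i i≤s x = begin
  potential s (suc i) x - scaled s (bipower i (suc s ∸ i)) x
    ≡⟨ cong (λ r → potential s (suc i) x - scaled s (bipower i r) x) (+-∸-assoc 1 i≤s) ⟩
  potential s (suc i) x - scaled s (bipower i (suc (s ∸ i))) x
    ≡⟨ sym (scaled-minus s (bipower (suc i) (s ∸ i)) (bipower i (suc (s ∸ i))) x) ⟩
  scaled s (λ y → bipower (suc i) (s ∸ i) y - bipower i (suc (s ∸ i)) y) x
    ≡⟨ scaled-cong s (bipower-minus i (s ∸ i)) x ⟩
  scaled s (bipower i (s ∸ i)) x ∎

signed-even : ∀ s i → i ≤ s → signed (double s) (double i) ≗ (λ x → potential s (suc i) x - potential s i x)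
signed-odd  : ∀ s i → i < s → signed (double s) (suc (double i)) ≗ (λ _ → 0ℤ)
-- The start is `(1-t) Σ t^x = 1`, where `0 ^ 0 = 1` is essential.
signed-even zero    zero z≤n zero    = refl
signed-even zero    zero z≤n (suc x) = sym (trans (potential-minus 0 0 z≤n (suc x)) refl)
signed-even (suc s) i i≤s x = begin
  signed (double (suc s)) (double i) x
    ≡⟨ next-even′ s (Δ ∘ potential s) delay-Δu
         (next-even s (potential s) (delay-potential s) (signed-even s) (signed-odd s))
         (next-odd s (potential s) (delay-potential s) (signed-even s) (signed-odd s)) i i≤s x ⟩
  - Δ (Δ (potential s i)) x                             ≡⟨ scaled-suc s (bipower i (suc s ∸ i)) x ⟩
  scaled (suc s) (bipower i (suc s ∸ i)) x              ≡⟨ sym (potential-minus (suc s) i i≤s x) ⟩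
  potential (suc s) (suc i) x - potential (suc s) i x   ∎
  where
  delay-Δu : delay (Δ (potential s (suc s))) ≗ Δ (potential s 0)
  delay-Δu x = trans (delay-Δ (potential s (suc s)) x) (Δ-cong (delay-potential s) x)
signed-odd (suc s) i (s≤s i≤s) = next-odd′ s (Δ ∘ potential s) delay-Δu
  (next-even s (potential s) (delay-potential s) (signed-even s) (signed-odd s))
  (next-odd s (potential s) (delay-potential s) (signed-even s) (signed-odd s)) i i≤s
  where
  delay-Δu : delay (Δ (potential s (suc s))) ≗ Δ (potential s 0)
  delay-Δu x = trans (delay-Δ (potential s (suc s)) x) (Δ-cong (delay-potential s) x)

-- The telescoping yields `t` times the total, so the coefficient of the total at `x` is read off at
-- `suc x`; this turns the index `k - 1` into `k`.
signed-total : ∀ s x → prefix (signed (double s)) (suc (double s)) x ≡ alternating s *ᶻ Δ^ (double (suc s)) (power (suc s)) (suc x)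
signed-total s x = begin
  prefix (signed (double s)) (suc (double s)) x
    ≡⟨ delay-total s (potential s) (delay-potential s) (signed-even s) (signed-odd s) (suc x) ⟩
  Δ (potential s 0) (suc x)
    ≡⟨ Δ-scale (alternating s) (Δ^ (suc (double s)) (bipower 0 (suc s))) (suc x) ⟩
  alternating s *ᶻ Δ^ (double (suc s)) (bipower 0 (suc s)) (suc x)
    ≡⟨ cong (alternating s *ᶻ_) (Δ^-cong (double (suc s)) (λ y → cong pos (+-identityʳ (y ^ suc s))) (suc x)) ⟩
  alternating s *ᶻ Δ^ (double (suc s)) (power (suc s)) (suc x) ∎

-- Signed Eulerian numbers

sumℤ-cong : ∀ {A : Set} {f g : A → ℤ} xs → (∀ {x} → x ∈ xs → f x ≡ g x) → sumℤ f xs ≡ sumℤ g xs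
sumℤ-cong []       eq = refl
sumℤ-cong (x ∷ xs) eq = cong₂ _+ᶻ_ (eq (here refl)) (sumℤ-cong xs (eq ∘ there))

sumℤ-++ : ∀ {A : Set} (f : A → ℤ) xs ys → sumℤ f (xs ++ ys) ≡ sumℤ f xs +ᶻ sumℤ f ys
sumℤ-++ f []       ys = sym (ℤ.+-identityˡ _)
sumℤ-++ f (x ∷ xs) ys = trans (cong (f x +ᶻ_) (sumℤ-++ f xs ys)) (sym (ℤ.+-assoc (f x) (sumℤ f xs) (sumℤ f ys)))

sumℤ-map : ∀ {A B : Set} (f : B → ℤ) (g : A → B) xs → sumℤ f (map g xs) ≡ sumℤ (f ∘ g) xs
sumℤ-map f g []       = refl
sumℤ-map f g (x ∷ xs) = cong (f (g x) +ᶻ_) (sumℤ-map f g xs)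

sumℤ-scale : ∀ {A : Set} c (f : A → ℤ) xs → sumℤ (λ x → c *ᶻ f x) xs ≡ c *ᶻ sumℤ f xs
sumℤ-scale c f []       = sym (ℤ.*-zeroʳ c)
sumℤ-scale c f (x ∷ xs) = trans (cong (c *ᶻ f x +ᶻ_) (sumℤ-scale c f xs)) (sym (ℤ.*-distribˡ-+ c (f x) (sumℤ f xs)))

sumℤ-0 : ∀ {A : Set} (xs : List A) → sumℤ (λ _ → 0ℤ) xs ≡ 0ℤ
sumℤ-0 []       = refl
sumℤ-0 (x ∷ xs) = trans (ℤ.+-identityˡ _) (sumℤ-0 xs)

sumℤ-cartesianProductWith : ∀ {A B C : Set} (f : C → ℤ) (g : A → B → C) xs ys →
  sumℤ f (cartesianProductWith g xs ys) ≡ sumℤ (λ x → sumℤ (λ y → f (g x y)) ys) xs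
sumℤ-cartesianProductWith f g []       ys = refl
sumℤ-cartesianProductWith f g (x ∷ xs) ys = trans (sumℤ-++ f (map (g x) ys) (cartesianProductWith g xs ys))
  (cong₂ _+ᶻ_ (sumℤ-map f (g x) ys) (sumℤ-cartesianProductWith f g xs ys))

sumℤ-delay : ∀ {A : Set} (f : A → Series) xs → (λ x → sumℤ (λ a → delay (f a) x) xs) ≗ delay (λ x → sumℤ (λ a → f a x) xs)
sumℤ-delay f xs zero    = sumℤ-0 xs
sumℤ-delay f xs (suc x) = refl

sumℤ-letters : ∀ (f : ℕ → Series) M x → sumℤ (λ a → f a x) (letters M) ≡ prefix (f ∘ suc) M x
sumℤ-letters f zero    x = refl
sumℤ-letters f (suc M) x = begin
  sumℤ h (map suc (upTo (suc M)))              ≡⟨ cong (λ l → sumℤ h (map suc l)) (sym (upTo-∷ʳ M)) ⟩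
  sumℤ h (map suc (upTo M ++ (M ∷ [])))        ≡⟨ cong (sumℤ h) (map-++ suc (upTo M) (M ∷ [])) ⟩
  sumℤ h (letters M ++ (suc M ∷ []))           ≡⟨ sumℤ-++ h (letters M) (suc M ∷ []) ⟩
  sumℤ h (letters M) +ᶻ (h (suc M) +ᶻ 0ℤ)      ≡⟨ cong₂ _+ᶻ_ (sumℤ-letters f M x) (ℤ.+-identityʳ (h (suc M))) ⟩
  prefix (f ∘ suc) M x +ᶻ h (suc M)            ∎
  where
  h : ℕ → ℤ
  h a = f a x

sumℤ-perms-suc : ∀ (f : List ℕ → Series) N x → sumℤ (λ w → f w x) (perms (suc N)) ≡
                 prefix (λ β x → sumℤ (λ v → f (insert (suc β) v) x) (perms N)) (suc N) x
sumℤ-perms-suc f N x = trans (sumℤ-↭ (λ w → f w x) (perms-suc N))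
  (trans (sumℤ-cartesianProductWith (λ w → f w x) insert (letters (suc N)) (perms N))
    (sumℤ-letters (λ a x → sumℤ (λ v → f (insert a v) x) (perms N)) (suc N) x))

prefix-cong : ∀ {f g : ℕ → Series} a {x} → (∀ β → β < a → f β x ≡ g β x) → prefix f a x ≡ prefix g a x
prefix-cong zero    eq = refl
prefix-cong (suc a) eq = cong₂ _+ᶻ_ (prefix-cong a (λ β β<a → eq β (m<n⇒m<1+n β<a))) (eq a (n<1+n a))

prefix-scale : ∀ c (f : ℕ → Series) a x → prefix (λ β y → c *ᶻ f β y) a x ≡ c *ᶻ prefix f a x
prefix-scale c f zero    x = sym (ℤ.*-zeroʳ c)
prefix-scale c f (suc a) x = trans (cong (_+ᶻ c *ᶻ f a x) (prefix-scale c f a x)) (sym (ℤ.*-distribˡ-+ c (prefix f a x) (f a x)))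

-- The contribution of second letter `β + 1`, taken before relabelling, behind first letter `α + 1`:
-- a factor `t` records the ascent between them, present when `β` is not below `α`.
mixed : ℕ → (ℕ → Series) → ℕ → Series
mixed α f β x = if β <ᵇ α then f β x else delay (f β) x

-- Letters below `α` count without `t` and the others with it, so the sum is `(1-t)` times the first
-- part plus `t` times everything. The length is written `r + α` to allow induction on the part
-- beyond `α`.
prefix-mixed : ∀ f α r x → prefix (mixed α f) (r + α) x ≡ Δ (prefix f α) x +ᶻ delay (prefix f (r + α)) x
prefix-mixed f α zero x = trans (prefix-cong α mixed-<) (r (prefix f α x) (delay (prefix f α) x))
  where
  mixed-< : ∀ β → β < α → mixed α f β x ≡ f β x
  mixed-< β β<α with β <ᵇ α | <⇒<ᵇ β<α
  ... | true | _ = refl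
  r : ∀ a b → a ≡ a - b +ᶻ b
  r = ℤSolver.solve-∀
prefix-mixed f α (suc r) x = begin
  prefix (mixed α f) (r + α) x +ᶻ mixed α f (r + α) x
    ≡⟨ cong₂ _+ᶻ_ (prefix-mixed f α r x) mixed-≥ ⟩
  Δ (prefix f α) x +ᶻ delay (prefix f (r + α)) x +ᶻ delay (f (r + α)) x
    ≡⟨ ℤ.+-assoc (Δ (prefix f α) x) _ _ ⟩
  Δ (prefix f α) x +ᶻ (delay (prefix f (r + α)) x +ᶻ delay (f (r + α)) x)
    ≡⟨ cong (Δ (prefix f α) x +ᶻ_) (sym (delay-plus x)) ⟩
  Δ (prefix f α) x +ᶻ delay (prefix f (suc r + α)) x ∎
  where
  mixed-≥ : mixed α f (r + α) x ≡ delay (f (r + α)) x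
  mixed-≥ with (r + α) <ᵇ α in eq
  ... | true  = contradiction (<ᵇ⇒< (r + α) α (subst T (sym eq) _)) (≤⇒≯ (m≤n+m α r))
  ... | false = refl
  delay-plus : ∀ x → delay (prefix f (suc r + α)) x ≡ delay (prefix f (r + α)) x +ᶻ delay (f (r + α)) x
  delay-plus zero    = refl
  delay-plus (suc x) = refl

skip-<ᵇ-skip : ∀ a x y → (skip a x <ᵇ skip a y) ≡ (x <ᵇ y)
skip-<ᵇ-skip zero    x       y       = refl
skip-<ᵇ-skip (suc a) zero    zero    = refl
skip-<ᵇ-skip (suc a) zero    (suc y) = refl
skip-<ᵇ-skip (suc a) (suc x) zero    = refl
skip-<ᵇ-skip (suc a) (suc x) (suc y) = skip-<ᵇ-skip a x y

skip-<ᵇ : ∀ a x → (skip a x <ᵇ a) ≡ (x <ᵇ a)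
skip-<ᵇ zero    x       = refl
skip-<ᵇ (suc a) zero    = refl
skip-<ᵇ (suc a) (suc x) = skip-<ᵇ a x

<ᵇ-skip : ∀ a x → (a <ᵇ skip a x) ≡ not (x <ᵇ a)
<ᵇ-skip zero    x       = refl
<ᵇ-skip (suc a) zero    = refl
<ᵇ-skip (suc a) (suc x) = <ᵇ-skip a x

countᵇ-map : ∀ {A B : Set} (p : B → Bool) {q : A → Bool} (f : A → B) → (∀ x → p (f x) ≡ q x) →
             ∀ xs → countᵇ p (map f xs) ≡ countᵇ q xs
countᵇ-map p {q} f eq []       = refl
countᵇ-map p {q} f eq (x ∷ xs) rewrite eq x with q x
... | true  = cong suc (countᵇ-map p f eq xs)
... | false = countᵇ-map p f eq xs

inversions-skip : ∀ a l → inversions (map (skip a) l) ≡ inversions l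
inversions-skip a []      = refl
inversions-skip a (x ∷ l) = cong₂ _+_ (countᵇ-map (_<ᵇ skip a x) (skip a) (λ y → skip-<ᵇ-skip a y x) l) (inversions-skip a l)

inversions-insert : ∀ {N v α} → IsPerm N v → α ≤ N → inversions (insert (suc α) v) ≡ α + inversions v
inversions-insert {N} {v} {α} v-perm α≤N = cong₂ _+_
  (trans (countᵇ-map (_<ᵇ suc α) (skip (suc α)) (skip-<ᵇ (suc α)) v) (below-perm v-perm α≤N))
  (inversions-skip (suc α) v)

ascents-skip : ∀ a l → ascents (map (skip a) l) ≡ ascents l
ascents-skip a []          = refl
ascents-skip a (x ∷ [])    = refl
ascents-skip a (x ∷ y ∷ l) = cong₂ (λ b n → (if b then 1 else 0) + n) (skip-<ᵇ-skip a x y) (ascents-skip a (y ∷ l))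

ascents-insert : ∀ a b v → ascents (insert (suc a) (suc b ∷ v)) ≡ (if b <ᵇ a then 0 else 1) + ascents (suc b ∷ v)
ascents-insert a b v rewrite <ᵇ-skip a b | ascents-skip (suc a) (suc b ∷ v) with b <ᵇ a
... | true  = refl
... | false = refl

alternating-+ : ∀ m n → alternating (m + n) ≡ alternating m *ᶻ alternating n
alternating-+ zero    n = sym (ℤ.*-identityˡ _)
alternating-+ (suc m) n = trans (cong -_ (alternating-+ m n)) (ℤ.neg-distribˡ-* (alternating m) (alternating n))

weight : List ℕ → Series
weight w x = alternating (inversions w) *ᶻ monomial (ascents w) x

delay-monomial : ∀ a → delay (monomial a) ≗ monomial (suc a)
delay-monomial a zero    = refl
delay-monomial a (suc x) = refl

weight-insert : ∀ {N α β v} → IsPerm (suc N) (insert (suc β) v) → α ≤ suc N → ∀ x →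
  weight (insert (suc α) (insert (suc β) v)) x ≡
  alternating α *ᶻ (if β <ᵇ α then weight (insert (suc β) v) x else delay (weight (insert (suc β) v)) x)
weight-insert {N} {α} {β} {v} perm α≤ x
  rewrite inversions-insert perm α≤ | ascents-insert α β (map (skip (suc β)) v)
        | alternating-+ α (inversions (insert (suc β) v)) with β <ᵇ α
... | true  = ℤ.*-assoc (alternating α) _ _
... | false = trans (ℤ.*-assoc (alternating α) (alternating (inversions (insert (suc β) v))) _)
  (cong (alternating α *ᶻ_) (trans
    (cong (alternating (inversions (insert (suc β) v)) *ᶻ_) (sym (delay-monomial (ascents (insert (suc β) v)) x)))
    (sym (delay-scale (alternating (inversions (insert (suc β) v))) (monomial (ascents (insert (suc β) v))) x))))

-- Classifying by the second letter reproduces the recursion of `signed`: the first letter causes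
-- `α` inversions whatever follows, and whether it starts an ascent depends on the second letter
-- only.
sum-weight-insert : ∀ N α → α ≤ N → ∀ x → sumℤ (λ v → weight (insert (suc α) v) x) (perms N) ≡ signed N α x
sum-weight-insert zero    α _  x = trans (ℤ.+-identityʳ _) (ℤ.*-identityˡ _)
sum-weight-insert (suc N) α α≤ x = begin
  sumℤ (λ v → weight (insert (suc α) v) x) (perms (suc N))
    ≡⟨ sumℤ-perms-suc (λ v → weight (insert (suc α) v)) N x ⟩
  prefix (λ β x → sumℤ (λ v → weight (insert (suc α) (insert (suc β) v)) x) (perms N)) (suc N) x
    ≡⟨ prefix-cong (suc N) by-second ⟩
  prefix (λ β y → alternating α *ᶻ mixed α (signed N) β y) (suc N) x
    ≡⟨ prefix-scale (alternating α) (mixed α (signed N)) (suc N) x ⟩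
  alternating α *ᶻ prefix (mixed α (signed N)) (suc N) x
    ≡⟨ cong (λ k → alternating α *ᶻ prefix (mixed α (signed N)) k x) (sym (m∸n+n≡m α≤)) ⟩
  alternating α *ᶻ prefix (mixed α (signed N)) (suc N ∸ α + α) x
    ≡⟨ cong (alternating α *ᶻ_) (prefix-mixed (signed N) α (suc N ∸ α) x) ⟩
  alternating α *ᶻ (Δ (prefix (signed N) α) x +ᶻ delay (prefix (signed N) (suc N ∸ α + α)) x)
    ≡⟨ cong (λ k → alternating α *ᶻ (Δ (prefix (signed N) α) x +ᶻ delay (prefix (signed N) k) x)) (m∸n+n≡m α≤) ⟩
  signed (suc N) α x ∎
  where
  insert-perm : ∀ {β v} → β < suc N → v ∈ perms N → IsPerm (suc N) (insert (suc β) v)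
  insert-perm β< v∈ = ∈-perms⁻ (∈-resp-↭ (↭-sym (perms-suc N)) (∈-cartesianProductWith⁺ insert (∈-letters⁺ β<) v∈))

  by-second : ∀ β → β < suc N →
    sumℤ (λ v → weight (insert (suc α) (insert (suc β) v)) x) (perms N) ≡ alternating α *ᶻ mixed α (signed N) β x
  by-second β β<@(s≤s β≤) = begin
    sumℤ (λ v → weight (insert (suc α) (insert (suc β) v)) x) (perms N)
      ≡⟨ sumℤ-cong (perms N) (λ {v} v∈ → weight-insert {v = v} (insert-perm β< v∈) α≤ x) ⟩
    sumℤ (λ v → alternating α *ᶻ (if β <ᵇ α then weight (insert (suc β) v) x else delay (weight (insert (suc β) v)) x)) (perms N)
      ≡⟨ sumℤ-scale (alternating α) _ (perms N) ⟩
    alternating α *ᶻ sumℤ (λ v → if β <ᵇ α then weight (insert (suc β) v) x else delay (weight (insert (suc β) v)) x) (perms N)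
      ≡⟨ cong (alternating α *ᶻ_) distribute ⟩
    alternating α *ᶻ mixed α (signed N) β x ∎
    where
    distribute : sumℤ (λ v → if β <ᵇ α then weight (insert (suc β) v) x else delay (weight (insert (suc β) v)) x) (perms N) ≡
                 mixed α (signed N) β x
    distribute with β <ᵇ α
    ... | true  = sum-weight-insert N β β≤ x
    ... | false = trans (sumℤ-delay (λ v → weight (insert (suc β) v)) (perms N) x)
      (delay-cong (sum-weight-insert N β β≤) x)

signed-count : ∀ {A : Set} (h e : A → Bool) xs →
  pos (countᵇ (λ x → h x ∧ e x) xs) - pos (countᵇ (λ x → h x ∧ not (e x)) xs) ≡
  sumℤ (λ x → if h x then (if e x then 1ℤ else -1ℤ) else 0ℤ) xs
signed-count h e [] = refl
signed-count h e (x ∷ xs) with h x | e x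
... | false | _     = trans (signed-count h e xs) (sym (ℤ.+-identityˡ _))
... | true  | true  = trans (cong (_- pos b) (ℤ.pos-+ 1 a)) (trans (r (pos a) (pos b)) (cong (1ℤ +ᶻ_) (signed-count h e xs)))
  where
  a = countᵇ (λ x → h x ∧ e x) xs
  b = countᵇ (λ x → h x ∧ not (e x)) xs
  r : ∀ a b → 1ℤ +ᶻ a - b ≡ 1ℤ +ᶻ (a - b)
  r = ℤSolver.solve-∀
... | true  | false = trans (cong (λ z → pos a - z) (ℤ.pos-+ 1 b)) (trans (r (pos a) (pos b)) (cong (-1ℤ +ᶻ_) (signed-count h e xs)))
  where
  a = countᵇ (λ x → h x ∧ e x) xs
  b = countᵇ (λ x → h x ∧ not (e x)) xs
  r : ∀ a b → a - (1ℤ +ᶻ b) ≡ -1ℤ +ᶻ (a - b)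
  r = ℤSolver.solve-∀

monomial-self : ∀ a → monomial a a ≡ 1ℤ
monomial-self zero    = refl
monomial-self (suc a) = monomial-self a

monomial-≢ : ∀ a j → a ≢ j → monomial a j ≡ 0ℤ
monomial-≢ zero    zero    a≢j = contradiction refl a≢j
monomial-≢ zero    (suc j) _   = refl
monomial-≢ (suc a) zero    _   = refl
monomial-≢ (suc a) (suc j) a≢j = monomial-≢ a j (a≢j ∘ cong suc)

signed-indicator : ∀ j w → (if hasAsc (pos j) w then (if isEvenPerm w then 1ℤ else -1ℤ) else 0ℤ) ≡ weight w j
signed-indicator j w with pos (ascents w) ℤ.≟ pos j
... | no  a≢j = sym (trans (cong (alternating (inversions w) *ᶻ_) (monomial-≢ (ascents w) j (a≢j ∘ cong pos)))
  (ℤ.*-zeroʳ (alternating (inversions w))))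
... | yes a≡j rewrite sym (ℤ.+-injective a≡j) | monomial-self (ascents w) | isEvenPerm-odd w | alternating-odd (inversions w)
  with odd (inversions w)
...   | true  = refl
...   | false = refl

D-total : ∀ N j → D (suc N) (pos j) ≡ prefix (signed N) (suc N) j
D-total N j = begin
  D (suc N) (pos j)                                     ≡⟨ signed-count (hasAsc (pos j)) isEvenPerm (perms (suc N)) ⟩
  sumℤ _ (perms (suc N))                                ≡⟨ sumℤ-cong (perms (suc N)) (λ {w} _ → signed-indicator j w) ⟩
  sumℤ (λ w → weight w j) (perms (suc N))               ≡⟨ sumℤ-perms-suc weight N j ⟩
  prefix (λ β x → sumℤ (λ v → weight (insert (suc β) v) x) (perms N)) (suc N) j
    ≡⟨ prefix-cong (suc N) (λ { β (s≤s β≤) → sum-weight-insert N β β≤ j }) ⟩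
  prefix (signed N) (suc N) j                           ∎

countᵇ-false : ∀ {A : Set} (xs : List A) → countᵇ (λ _ → false) xs ≡ 0
countᵇ-false []       = refl
countᵇ-false (x ∷ xs) = countᵇ-false xs

D-negative : ∀ N x → D N -[1+ x ] ≡ 0ℤ
D-negative N x = cong₂ (λ b c → pos b - pos c) (countᵇ-false (perms N)) (countᵇ-false (perms N))

-- Divisibility of `D`

n<2^n : ∀ n → n < 2 ^ n
n<2^n zero    = s≤s z≤n
n<2^n (suc n) = ≤-trans (s≤s (n<2^n n)) (subst (suc (2 ^ n) ≤_) (cong (2 ^ n +_) (sym (+-identityʳ _)))
  (+-monoˡ-≤ (2 ^ n) (m^n>0 2 n)))

double≡*2 : ∀ n → double n ≡ n * 2
double≡*2 zero    = refl
double≡*2 (suc n) = cong (suc ∘ suc) (double≡*2 n)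

-- If `m` exceeded `r = s + 1`, then `2 * 2^r ≤ 2^m ≤ p^m ≤ 2 r`, against `r < 2^r`.
exponent-bound : ∀ {p m s} → 1 < p → p ^ m ∣ℕ double (suc s) → m ≤ suc s
exponent-bound {p} {m} {s} 1<p p^m∣ = ≮⇒≥ λ s<m → <⇒≱ (n<2^n (suc s)) (*-cancelʳ-≤ (2 ^ suc s) (suc s) 2
  (≤-trans (≤-reflexive (*-comm (2 ^ suc s) 2)) (≤-trans (^-monoʳ-≤ 2 s<m) (≤-trans (^-monoˡ-≤ m 1<p)
    (≤-trans (∣⇒≤ p^m∣) (≤-reflexive (double≡*2 (suc s))))))))

odd-double : ∀ s → odd (double s) ≡ false
odd-double zero    = refl
odd-double (suc s) = trans (not-involutive _) (odd-double s)

D-divisible : ∀ {p m s} → 1 < p → p ^ m ∣ℕ double (suc s) → ∀ k → pos p ∣ k → pos (p ^ m) ∣ D (suc (double s)) (k - 1ℤ)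
D-divisible {p} {m} {s} 1<p p^m∣n (pos (suc j)) p∣k = Signed.∣⇒∣ᵤ (subst (pos (p ^ m) ∣ᶻ_)
  (sym (trans (D-total (double s) j) (signed-total s j)))
  (Signed.∣n⇒∣m*n (alternating s) (p^m∣Δ^-power {p} {m} (exponent-bound 1<p p^m∣n) p^m∣n p∣k)))
-- For `k ≤ 0` the number `k - 1` of ascents is negative and both counts are 0.
D-divisible {p} {m} {s} _ _ (pos zero) _ = subst (pos (p ^ m) ∣_) (sym (D-negative (suc (double s)) 0)) (divides 0 refl)
D-divisible {p} {m} {s} _ _ -[1+ x ]   _ = subst (pos (p ^ m) ∣_) (sym (D-negative (suc (double s)) (suc (x + 0)))) (divides 0 refl)

open import Data.Integer using (+_)

-- Divisibility

-- The product `p ^ m * i` is divisible by `p ^ m` and `i` is not, so descending from `m` meets an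
-- exponent at which divisibility is first lost. This replaces a nontrivial stabiliser element by
-- one of order `p`.
p-power-multiple : ∀ p m {i} → p ^ m ∤ i → ∃ λ l → p ^ m ∤ p ^ l * i × p ^ m ∣ℕ p * (p ^ l * i)
p-power-multiple p m {i} q∤i = go m (m∣m*n i)
  where
  go : ∀ l → p ^ m ∣ℕ p ^ l * i → ∃ λ l → p ^ m ∤ p ^ l * i × p ^ m ∣ℕ p * (p ^ l * i)
  go zero    q∣ = contradiction (subst (p ^ m ∣ℕ_) (+-identityʳ i) q∣) q∤i
  go (suc l) q∣ with p ^ m ∣? p ^ l * i
  ... | yes q∣′ = go l q∣′
  ... | no  q∤  = l , q∤ , subst (p ^ m ∣ℕ_) (*-assoc p (p ^ l) i) q∣

iterate-fix : ∀ {A : Set} (g : A → A) {x} i → iterate g x i ≡ x → ∀ j → iterate g x (j * i) ≡ x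
iterate-fix g i fix zero    = refl
iterate-fix g i fix (suc j) = trans (iterate-+ g _ i (j * i))
  (trans (cong (λ y → iterate g y (j * i)) fix) (iterate-fix g i fix j))

iterate-* : ∀ {A : Set} (g : A → A) x t i → iterate (λ y → iterate g y t) x i ≡ iterate g x (i * t)
iterate-* g x t zero    = refl
iterate-* g x t (suc i) = trans (iterate-* g (iterate g x t) t i) (sym (iterate-+ g x t (i * t)))

-- The predicate `f` stays abstract so that `S`, `P` and `Q` share the argument; the acting group is
-- generated by `rho` iterated `t = n / p^m` times.
∣-count : ∀ (f : List ℕ → Bool) {p m t N : ℕ} {k} .{{_ : NonZero p}} → suc N ≡ t * p ^ m → 0 < N → (+ p) ∣ k →
          (∀ {w} → IsPerm N w → f w ≡ true → f (Rotation.rho (suc N) w) ≡ true) →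
          p ^ m ∣ℕ countᵇ (λ w → hasAsc (k - 1ℤ) w ∧ f w) (perms N)
∣-count f {p} {m} {t} {N} {k} n≡tq N>0 p∣k f-rho =
  subst₂ _∣ℕ_ (sym q-def) (cong length (sym (filterᵇ≡filter good (perms N))))
    (free⇒∣length (≡-dec _≟_) g q goods (Unique.filter⁺ (T? ∘ good) (perms-unique N)) closed period free)
  where
  open Rotation (suc N)
  open Symmetry (suc N)
  q : ℕ
  q = pred (p ^ m)
  q-def : p ^ m ≡ suc q
  q-def = sym (suc-pred (p ^ m) {{m^n≢0 p m}})
  n≡t*suc-q : suc N ≡ t * suc q
  n≡t*suc-q = trans n≡tq (cong (t *_) q-def)
  good : List ℕ → Bool
  good w = hasAsc (k - 1ℤ) w ∧ f w
  goods : List (List ℕ)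
  goods = filter (T? ∘ good) (perms N)
  g : List ℕ → List ℕ
  g w = iterate rho w t

  goods⁻ : ∀ {w} → w ∈ goods → IsPerm N w × T (hasAsc (k - 1ℤ) w) × T (f w)
  goods⁻ w∈ = let (w∈′ , t) = ∈-filter⁻ (T? ∘ good) w∈ in ∈-perms⁻ w∈′ , Equivalence.to T-∧ t

  rho-closed : ∀ {w} → w ∈ goods → rho w ∈ goods
  rho-closed w∈ = let (w-perm , asc , fw) = goods⁻ w∈ in
    ∈-filter⁺ (T? ∘ good) (∈-perms⁺ (rho-perm refl w-perm))
      (Equivalence.from T-∧ (subst (λ a → T ⌊ (+ a) ℤ.≟ k - 1ℤ ⌋) (sym (rho-ascents refl N>0 w-perm)) asc
                            , Equivalence.from T-≡ (f-rho w-perm (Equivalence.to T-≡ fw))))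

  closed : ∀ {w} → w ∈ goods → g w ∈ goods
  closed = go t
    where
    go : ∀ i {w} → w ∈ goods → iterate rho w i ∈ goods
    go zero    w∈ = w∈
    go (suc i) w∈ = go i (rho-closed w∈)

  period : ∀ {w} → w ∈ goods → iterate g w (suc q) ≡ w
  period {w} w∈ = let w-perm = proj₁ (goods⁻ w∈) in
    trans (iterate-* rho w t (suc q)) (trans (cong (iterate rho w) (trans (*-comm (suc q) t) (sym n≡t*suc-q)))
      (rho-period w (perm-bounded w-perm) (cong suc (IsPerm.len w-perm))))

  p∣walk : ∀ {w} → w ∈ goods → ∃ λ e → walk (suc N) (0 ∷ w) ≡ p * e
  p∣walk {w} w∈ with w-perm , asc , _ ← goods⁻ w∈ =
    quotient p∣k , (begin
      walk (suc N) (0 ∷ w)              ≡⟨ cong (λ l → walk (suc l) (0 ∷ w)) (sym len) ⟩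
      walk (suc (length w)) (0 ∷ w)     ≡⟨ walk-around (subst (0 <_) (sym len) N>0) (perm-positive w-perm) ⟩
      -- The equation `suc (ascents w) = k` holds in the integers and so shows that `k` is positive;
      -- its absolute value is `k` itself.
      suc (ascents w)                   ≡⟨ cong ℤ.∣_∣ (ascents≡ (toWitness asc)) ⟩
      ℤ.∣ k ∣                ≡⟨ trans (_∣ℕ_.equality p∣k) (*-comm (quotient p∣k) p) ⟩
      p * quotient p∣k                             ∎)
    where
    len = IsPerm.len w-perm
    ascents≡ : ∀ {a} → + a ≡ k - 1ℤ → + suc a ≡ k
    ascents≡ {a} eq = trans (cong (1ℤ +ᶻ_) eq) (r k)
      where
      r : ∀ k → 1ℤ +ᶻ (k - 1ℤ) ≡ k
      r = ℤSolver.solve-∀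

  free : ∀ {w i} → w ∈ goods → 0 < i → i < suc q → iterate g w i ≢ w
  free {w} {i} w∈ i>0 i<q fix
    with l , q∤ , divides v pl≡ ← p-power-multiple p m {i}
           (subst (_∤ i) (sym q-def) (>⇒∤ {{>-nonZero i>0}} i<q))
    with e , walk≡ ← p∣walk w∈
    = <⇒≢ (first-positive′ (perm-positive w-perm) n∤u) (sym
        (fixed⇒first≡0 w (perm-bounded w-perm) (cong suc len) {u} {p} {v} {e} fix-u pu≡vn walk≡))
    where
    w-perm = proj₁ (goods⁻ w∈)
    len    = IsPerm.len w-perm
    -- If `rho` iterated `i * t` times fixes `w`, so does its `p ^ l`-th power; `l` is chosen so
    -- that `n = t p^m` divides `p * u` but not `u`.
    u = p ^ l * i * t
    fix-u : iterate rho w u ≡ w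
    fix-u = subst (λ j → iterate rho w j ≡ w) (sym (*-assoc (p ^ l) i t))
      (iterate-fix rho (i * t) (trans (sym (iterate-* rho w t i)) fix) (p ^ l))
    pu≡vn : p * u ≡ v * suc N
    pu≡vn = begin
      p * (p ^ l * i * t)    ≡⟨ sym (*-assoc p (p ^ l * i) t) ⟩
      p * (p ^ l * i) * t    ≡⟨ cong (_* t) pl≡ ⟩
      v * p ^ m * t          ≡⟨ *-assoc v (p ^ m) t ⟩
      v * (p ^ m * t)        ≡⟨ cong (v *_) (trans (cong (_* t) q-def) (trans (*-comm (suc q) t) (sym n≡t*suc-q))) ⟩
      v * suc N              ∎
    t-nonZero : NonZero t
    t-nonZero = ≢-nonZero λ { refl → contradiction n≡t*suc-q λ () }
    n∤u : suc (length w) ∤ u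
    n∤u n∣u = q∤ (*-cancelʳ-∣ t {{t-nonZero}}
      (subst (_∣ℕ u) (trans (cong suc len) (trans n≡t*suc-q (trans (*-comm t (suc q)) (cong (_* t) (sym q-def))))) n∣u))

-- The five divisibilities

theorem5p2 : (p m n : ℕ) (k : ℤ) → Prime p → 1 ≤ m → 1 ≤ n → 2 ∣ℕ n → (p ^ m) ∣ℕ n → (+ p) ∣ k →
    ((+ (p ^ m)) ∣ S (n ∸ 1) (k - 1ℤ)) × ((+ (p ^ m)) ∣ P (n ∸ 1) (k - 1ℤ)) × ((+ (p ^ m)) ∣ Q (n ∸ 1) (k - 1ℤ))
    × ((+ (p ^ m)) ∣ R (n ∸ 1) (k - 1ℤ)) × ((+ (p ^ m)) ∣ D (n ∸ 1) (k - 1ℤ))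
theorem5p2 p m n k p-prime _ 1≤n (divides zero refl) _ _ = contradiction 1≤n λ ()
theorem5p2 p m n k p-prime _ _ (divides (suc s) n≡) q∣n p∣k = go n (trans n≡ (sym (double≡*2 (suc s)))) q∣n
  where
  -- Stated for a variable `n` so that it can be replaced by `double (suc s)`; then `n ∸ 1` computes
  -- to `suc (double s)`, the form in which `D` is evaluated.
  go : ∀ n → n ≡ double (suc s) → p ^ m ∣ℕ n →
       ((+ (p ^ m)) ∣ S (n ∸ 1) (k - 1ℤ)) × ((+ (p ^ m)) ∣ P (n ∸ 1) (k - 1ℤ)) × ((+ (p ^ m)) ∣ Q (n ∸ 1) (k - 1ℤ))
       × ((+ (p ^ m)) ∣ R (n ∸ 1) (k - 1ℤ)) × ((+ (p ^ m)) ∣ D (n ∸ 1) (k - 1ℤ))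
  go .(double (suc s)) refl q∣n@(divides t n≡tq) =
    ∣-PAP isPAP rho-PAP′ , ∣P , ∣Q ,
    Signed.∣⇒∣ᵤ (Signed.∣m∣n⇒∣m-n {m = P N (k - 1ℤ)} {Q N (k - 1ℤ)} (Signed.∣ᵤ⇒∣ {+ (p ^ m)} ∣P) (Signed.∣ᵤ⇒∣ {+ (p ^ m)} ∣Q)) ,
    D-divisible {p} {m} (nonTrivial⇒n>1 p {{prime⇒nonTrivial p-prime}}) q∣n k p∣k
    where
    N : ℕ
    N = suc (double s)
    open Rotation (suc N)
    open Symmetry (suc N)

    even-n : odd (suc N) ≡ false
    even-n = odd-double (suc s)

    rho-PAP′ : ∀ {w} → IsPerm N w → isPAP w ≡ true → isPAP (rho w) ≡ true
    rho-PAP′ = rho-PAP even-n refl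

    ∣-PAP : ∀ f → (∀ {w} → IsPerm N w → f w ≡ true → f (rho w) ≡ true) →
            p ^ m ∣ℕ countᵇ (λ w → hasAsc (k - 1ℤ) w ∧ f w) (perms N)
    ∣-PAP f = ∣-count f {p} {m} {t} {k = k} {{prime⇒nonZero p-prime}} n≡tq (s≤s z≤n) p∣k

    rho-parity : ∀ {w} → IsPerm N w → isPAP w ≡ true → isEvenPerm (rho w) ≡ isEvenPerm w
    rho-parity {w} w-perm pap = begin
      isEvenPerm (rho w)             ≡⟨ isEvenPerm-odd (rho w) ⟩
      not (odd (inversions (rho w))) ≡⟨ cong not (rho-inversions even-n refl w-perm pap) ⟩
      not (odd (inversions w))       ≡⟨ sym (isEvenPerm-odd w) ⟩
      isEvenPerm w                   ∎

    -- Taking `e` to be `id` or `not` treats the even and the odd PAPs at once.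
    rho-PAP∧ : ∀ (e : Bool → Bool) {w} → IsPerm N w → isPAP w ∧ e (isEvenPerm w) ≡ true →
               isPAP (rho w) ∧ e (isEvenPerm (rho w)) ≡ true
    rho-PAP∧ e {w} w-perm t with isPAP w in pap
    ... | true rewrite rho-PAP′ w-perm pap | rho-parity w-perm pap = t

    ∣P : p ^ m ∣ℕ countᵇ (λ w → hasAsc (k - 1ℤ) w ∧ isPAP w ∧ isEvenPerm w) (perms N)
    ∣P = ∣-PAP _ (rho-PAP∧ id)
    ∣Q : p ^ m ∣ℕ countᵇ (λ w → hasAsc (k - 1ℤ) w ∧ isPAP w ∧ not (isEvenPerm w)) (perms N)
    ∣Q = ∣-PAP _ (rho-PAP∧ not)
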